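{- For infinitely many integers $n>0$, and for any real $\alpha\geq1$ and integer $k$ such that $\alpha+1\leq k\leq\log n$, there is an $n$-vertex graph $G=(V,E)$ and a set of pairs $\mathcal{P}\subseteq V^2$ with size $|\mathcal{P}|=\Theta\left(\frac{\alpha}{k}\cdot n^{1+\frac{1}{k}}\right)$, such that any $\mathcal{P}$-pairwise $\alpha$-spanner for $G$ must have at least $\Omega(n^{1+\frac1k})$ edges; that is, the size overhead (number of edges of the spanner divided by $|\mathcal{P}|$) is at least $\beta=\Omega\left(\frac{k}{\alpha}\right)$.
   Context: Graphs are finite and undirected. $d_G(u,v)$ denotes the shortest path distance between $u$ and $v$ in $G$. Given $\mathcal{P}\subseteq V^2$ and $\alpha\ge1$, a $\mathcal{P}$-pairwise $\alpha$-spanner for $G=(V,E)$ is a subgraph $S=(V,E')$ of $G$ such that $d_S(u,v)\le\alpha\cdot d_G(u,v)$ for every $(u,v)\in\mathcal{P}$. The size overhead of such a spanner is $|E'|/|\mathcal{P}|$. Logarithms are base 2, and the constants hidden in $\Theta,\Omega$ are absolute. -}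

module Defs where

open import Data.Bool.Base using (Bool; false; T; _∧_)
open import Data.Fin.Base using (Fin)
open import Data.Fin.Properties using (_<?_)
import Data.Integer.Base as ℤ
import Data.Integer.Properties as ℤP
open import Data.List.Base using (length; filterᵇ; cartesianProduct; allFin)
open import Data.Nat.Base as ℕ using (ℕ; zero; suc)
import Data.Nat.Properties as ℕP
open import Data.Product.Base using (∃₂; ∃-syntax; _×_; _,_; proj₁; proj₂)
open import Data.Rational.Base as ℚ
  using (ℚ; 0ℚ; 1ℚ; _+_; _*_; _≤_; _<_; _/_; _⊔_; 1/_; NonNegative; Positive;
         positive; nonNegative; toℚᵘ; fromℚᵘ)
open import Data.Rational.Properties
  using (≤-refl; ≤-reflexive; ≤-trans; <⇒≤; ≰⇒>; _≤?_; <-irrefl; <-≤-trans; ≤-<-trans;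
         +-identityˡ; +-identityʳ; +-mono-≤; +-monoʳ-≤; +-monoˡ-≤;
         *-identityˡ; *-identityʳ; *-zeroˡ; *-zeroʳ; *-assoc; *-comm; *-inverseˡ; *-inverseʳ;
         *-monoˡ-≤-nonNeg; *-monoʳ-≤-nonNeg; *-monoˡ-<-pos; *-monoʳ-<-pos;
         *-cancelˡ-≤-pos; nonNegative⁻¹; positive⁻¹; pos⇒nonZero; 1/pos⇒pos;
         normalize-nonNeg; toℚᵘ-cancel-≤; toℚᵘ-injective; toℚᵘ-fromℚᵘ; toℚᵘ-homo-+;
         p≤p⊔q; p≤q⊔p; ⊔-sel; +-*-rawSemiring; module ≤-Reasoning)
open import Data.Rational.Solver using (module +-*-Solver)
import Data.Rational.Unnormalised.Base as ℚᵘ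
import Data.Rational.Unnormalised.Properties as ℚᵘP
open import Algebra.Definitions.RawSemiring +-*-rawSemiring using (_^_)
open import Data.Sum.Base using (inj₁; inj₂)
open import Relation.Binary.PropositionalEquality
  using (_≡_; refl; sym; trans; cong; cong₂; subst; subst₂)
open import Relation.Nullary using (yes; no; contradiction)
open import Relation.Nullary.Decidable using (⌊_⌋)

*-mono-≤ : ∀ {p q r s} → 0ℚ ≤ p → p ≤ q → 0ℚ ≤ r → r ≤ s → p * r ≤ q * s
*-mono-≤ {p} {q} {r} {s} 0≤p p≤q 0≤r r≤s =
  ≤-trans (*-monoʳ-≤-nonNeg r {{nonNegative 0≤r}} p≤q)
          (*-monoˡ-≤-nonNeg q {{nonNegative (≤-trans 0≤p p≤q)}} r≤s)

0≤+ : ∀ {p q} → 0ℚ ≤ p → 0ℚ ≤ q → 0ℚ ≤ p + q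
0≤+ 0≤p 0≤q = ≤-trans (≤-reflexive (sym (+-identityˡ 0ℚ))) (+-mono-≤ 0≤p 0≤q)

0≤* : ∀ {p q} → 0ℚ ≤ p → 0ℚ ≤ q → 0ℚ ≤ p * q
0≤* 0≤p 0≤q = ≤-trans (≤-reflexive (sym (*-zeroˡ 0ℚ))) (*-mono-≤ ≤-refl 0≤p ≤-refl 0≤q)

0<* : ∀ {p q} → 0ℚ < p → 0ℚ < q → 0ℚ < p * q
0<* {p} {q} 0<p 0<q =
  subst (_< p * q) (*-zeroʳ p) (*-monoʳ-<-pos p {{positive 0<p}} 0<q)

0≤1 : 0ℚ ≤ 1ℚ
0≤1 = nonNegative⁻¹ 1ℚ

p≤p+q : ∀ {p q} → 0ℚ ≤ q → p ≤ p + q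
p≤p+q {p} 0≤q = ≤-trans (≤-reflexive (sym (+-identityʳ p))) (+-monoʳ-≤ p 0≤q)

0≤^ : ∀ {p} k → 0ℚ ≤ p → 0ℚ ≤ p ^ k
0≤^ zero    0≤p = 0≤1
0≤^ (suc k) 0≤p = 0≤* 0≤p (0≤^ k 0≤p)

^-mono-≤ : ∀ {p q} k → 0ℚ ≤ p → p ≤ q → p ^ k ≤ q ^ k
^-mono-≤ zero    0≤p p≤q = ≤-refl
^-mono-≤ (suc k) 0≤p p≤q = *-mono-≤ 0≤p p≤q (0≤^ k 0≤p) (^-mono-≤ k 0≤p p≤q)

0<^ : ∀ {p} k → 0ℚ < p → 0ℚ < p ^ k
0<^ zero    0<p = positive⁻¹ 1ℚ
0<^ (suc k) 0<p = 0<* 0<p (0<^ k 0<p)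

^-mono-< : ∀ {p q} k .{{_ : ℕ.NonZero k}} → 0ℚ ≤ p → p < q → p ^ k < q ^ k
^-mono-< {p} {q} (suc k) 0≤p p<q = ≤-<-trans
  (*-monoˡ-≤-nonNeg p {{nonNegative 0≤p}} (^-mono-≤ k 0≤p (<⇒≤ p<q)))
  (*-monoˡ-<-pos (q ^ k) {{positive (0<^ k (≤-<-trans 0≤p p<q))}} p<q)

1≤^ : ∀ {p} k → 1ℚ ≤ p → 1ℚ ≤ p ^ k
1≤^ zero    1≤p = ≤-refl
1≤^ (suc k) 1≤p =
  ≤-trans (≤-reflexive (sym (*-identityˡ 1ℚ))) (*-mono-≤ 0≤1 1≤p 0≤1 (1≤^ k 1≤p))

0^k≤0 : ∀ k .{{_ : ℕ.NonZero k}} → 0ℚ ^ k ≤ 0ℚ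
0^k≤0 (suc k) = ≤-reflexive (*-zeroˡ (0ℚ ^ k))

p≤p^k : ∀ {p} k .{{_ : ℕ.NonZero k}} → 1ℚ ≤ p → p ≤ p ^ k
p≤p^k {p} (suc k) 1≤p = ≤-trans (≤-reflexive (sym (*-identityʳ p)))
  (*-mono-≤ (≤-trans 0≤1 1≤p) ≤-refl 0≤1 (1≤^ k 1≤p))

expand : ∀ p q r → (p + r) * (q + r) ≡ p * q + r * (p + q + r)
expand = solve 3 (λ p q r → (p :+ r) :* (q :+ r) := p :* q :+ r :* (p :+ q :+ r)) refl
  where open +-*-Solver

small : ∀ {M ε} → 0ℚ ≤ M → 0ℚ < ε → ∃[ δ ] 0ℚ < δ × δ ≤ 1ℚ × δ * M ≤ ε
small {M} {ε} 0≤M 0<ε = 1/ D * ε , 0<* 0<1/D 0<ε ,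
  ≤-trans (*-monoˡ-≤-nonNeg (1/ D) {{0≤1/D}} ε≤D) (≤-reflexive (*-inverseˡ D)) ,
  (begin
    1/ D * ε * M   ≡⟨ solve 3 (λ i e m → i :* e :* m := e :* (i :* m)) refl (1/ D) ε M ⟩
    ε * (1/ D * M) ≤⟨ *-monoˡ-≤-nonNeg ε {{nonNegative (<⇒≤ 0<ε)}}
                        (*-monoˡ-≤-nonNeg (1/ D) {{0≤1/D}} (p≤p+q (<⇒≤ 0<ε))) ⟩
    ε * (1/ D * D) ≡⟨ cong (ε *_) (*-inverseˡ D) ⟩
    ε * 1ℚ         ≡⟨ *-identityʳ ε ⟩
    ε              ∎)
  where
  open ≤-Reasoning
  open +-*-Solver
  D = M + ε
  ε≤D : ε ≤ D
  ε≤D = ≤-trans (≤-reflexive (sym (+-identityˡ ε))) (+-monoˡ-≤ ε 0≤M)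
  instance
    posD : Positive D
    posD = positive (<-≤-trans 0<ε ε≤D)
    nzD : ℚ.NonZero D
    nzD = pos⇒nonZero D
  0<1/D : 0ℚ < 1/ D
  0<1/D = positive⁻¹ (1/ D) {{1/pos⇒pos D}}
  0≤1/D : NonNegative (1/ D)
  0≤1/D = nonNegative (<⇒≤ 0<1/D)

*-close : ∀ {a b a′ b′ B C δ ε} → 0ℚ ≤ b → b ≤ a + δ → 0ℚ ≤ b′ → b′ ≤ a′ + δ →
          a ≤ B → a′ ≤ C → 0ℚ ≤ δ → δ ≤ 1ℚ → δ * (B + C + 1ℚ) ≤ ε → b * b′ ≤ a * a′ + ε
*-close {a} {b} {a′} {b′} {B} {C} {δ} {ε} 0≤b b≤ 0≤b′ b′≤ a≤B a′≤C 0≤δ δ≤1 δM≤ε = begin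
  b * b′                      ≤⟨ *-mono-≤ 0≤b b≤ 0≤b′ b′≤ ⟩
  (a + δ) * (a′ + δ)          ≡⟨ expand a a′ δ ⟩
  a * a′ + δ * (a + a′ + δ)   ≤⟨ +-monoʳ-≤ (a * a′) (*-monoˡ-≤-nonNeg δ {{nonNegative 0≤δ}}
                                   (+-mono-≤ (+-mono-≤ a≤B a′≤C) δ≤1)) ⟩
  a * a′ + δ * (B + C + 1ℚ)   ≤⟨ +-monoʳ-≤ (a * a′) δM≤ε ⟩
  a * a′ + ε                  ∎
  where open ≤-Reasoning

0≤/ : ∀ m d .{{_ : ℕ.NonZero d}} → 0ℚ ≤ ℤ.+ m / d
0≤/ m d = nonNegative⁻¹ (ℤ.+ m / d) {{normalize-nonNeg m d}}

suc/1 : ∀ m → ℤ.+ (suc m) / 1 ≡ 1ℚ + ℤ.+ m / 1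
suc/1 m = toℚᵘ-injective (begin
  toℚᵘ (fromℚᵘ (ℚᵘ.mkℚᵘ (ℤ.+ suc m) 0))           ≈⟨ toℚᵘ-fromℚᵘ (ℚᵘ.mkℚᵘ (ℤ.+ suc m) 0) ⟩
  ℚᵘ.mkℚᵘ (ℤ.+ suc m) 0                           ≈⟨ ℚᵘ.*≡* (cong (λ z → z ℤ.* ℤ.+ 1) (cong (λ z → ℤ.+ 1 ℤ.+ z) (sym (ℤP.*-identityʳ (ℤ.+ m))))) ⟩
  ℚᵘ.1ℚᵘ ℚᵘ.+ ℚᵘ.mkℚᵘ (ℤ.+ m) 0                   ≈⟨ ℚᵘP.+-congʳ ℚᵘ.1ℚᵘ (ℚᵘP.≃-sym (toℚᵘ-fromℚᵘ (ℚᵘ.mkℚᵘ (ℤ.+ m) 0))) ⟩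
  ℚᵘ.1ℚᵘ ℚᵘ.+ toℚᵘ (ℤ.+ m / 1)                    ≈⟨ ℚᵘP.≃-sym (toℚᵘ-homo-+ 1ℚ (ℤ.+ m / 1)) ⟩
  toℚᵘ (1ℚ + ℤ.+ m / 1)                           ∎)
  where open ℚᵘP.≃-Reasoning

bound : ∀ q → ∃[ m ] q ≤ ℤ.+ m / 1
bound q@(ℚ.mkℚ n d-1 _) = ℤ.∣ n ∣ , toℚᵘ-cancel-≤
  (ℚᵘP.≤-respʳ-≃ (ℚᵘP.≃-sym (toℚᵘ-fromℚᵘ (ℚᵘ.mkℚᵘ (ℤ.+ ℤ.∣ n ∣) 0))) (ℚᵘ.*≤* (lem n)))
  where
  lem : ∀ n → n ℤ.* ℤ.+ 1 ℤ.≤ ℤ.+ ℤ.∣ n ∣ ℤ.* ℤ.+ suc d-1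
  lem (ℤ.+ n)      = subst₂ ℤ._≤_ (ℤP.pos-* n 1) (ℤP.pos-* n (suc d-1))
                       (ℤ.+≤+ (ℕP.*-monoʳ-≤ n (ℕ.s≤s ℕ.z≤n)))
  lem (ℤ.-[1+ n ]) = ℤ.-≤+

-- A nonnegative real is given by a set L of rational lower bounds and a set U
-- of rational upper bounds that come arbitrarily close to each other.  L and U
-- need not contain all such bounds, so several presentations denote the same
-- real, namely sup L = inf U; the order below depends only on this value.

record ℝ≥0 : Set₁ where
  field
    L U     : ℚ → Set
    nonNeg  : ∀ {a} → L a → 0ℚ ≤ a
    ordered : ∀ {a b} → L a → U b → a ≤ b
    tight   : ∀ {ε} → 0ℚ < ε → ∃₂ λ a b → L a × U b × b ≤ a + ε

  U-nonNeg : ∀ {b} → U b → 0ℚ ≤ b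
  U-nonNeg Ub with _ , _ , La , _ ← tight (positive⁻¹ 1ℚ) = ≤-trans (nonNeg La) (ordered La Ub)

open ℝ≥0

infix  4 _≤ᴿ_
infixl 6 _+ᴿ_
infixl 7 _*ᴿ_ _/ᴺ_
infix  8 _^1+1/_

_≤ᴿ_ : ℝ≥0 → ℝ≥0 → Set
x ≤ᴿ y = ∀ {a b} → L x a → U y b → a ≤ b

0<_ : ℝ≥0 → Set
0< x = ∃[ a ] L x a × 0ℚ < a

fromℚ : (q : ℚ) → 0ℚ ≤ q → ℝ≥0
fromℚ q 0≤q .L a = a ≡ q
fromℚ q 0≤q .U b = b ≡ q
fromℚ q 0≤q .nonNeg refl = 0≤q
fromℚ q 0≤q .ordered refl refl = ≤-refl
fromℚ q 0≤q .tight 0<ε = q , q , refl , refl , p≤p+q (<⇒≤ 0<ε)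

ratio : (m d : ℕ) .{{_ : ℕ.NonZero d}} → ℝ≥0
ratio m d = fromℚ (ℤ.+ m / d) (0≤/ m d)

fromℕ : ℕ → ℝ≥0
fromℕ m = ratio m 1

_+ᴿ_ : ℝ≥0 → ℝ≥0 → ℝ≥0
(x +ᴿ y) .L c = ∃₂ λ a a′ → L x a × L y a′ × c ≡ a + a′
(x +ᴿ y) .U c = ∃₂ λ b b′ → U x b × U y b′ × c ≡ b + b′
(x +ᴿ y) .nonNeg (_ , _ , La , La′ , refl) = 0≤+ (nonNeg x La) (nonNeg y La′)
(x +ᴿ y) .ordered (_ , _ , La , La′ , refl) (_ , _ , Ub , Ub′ , refl) =
  +-mono-≤ (ordered x La Ub) (ordered y La′ Ub′)
(x +ᴿ y) .tight {ε} 0<ε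
  with a , b , La , Ub , b≤ ← tight x (0<* (positive⁻¹ ℚ.½) 0<ε)
     | a′ , b′ , La′ , Ub′ , b′≤ ← tight y (0<* (positive⁻¹ ℚ.½) 0<ε) =
  a + a′ , b + b′ , (a , a′ , La , La′ , refl) , (b , b′ , Ub , Ub′ , refl) ,
  ≤-trans (+-mono-≤ b≤ b′≤) (≤-reflexive
    (solve 3 (λ a a′ ε → (a :+ con ℚ.½ :* ε) :+ (a′ :+ con ℚ.½ :* ε) := (a :+ a′) :+ ε)
      refl a a′ ε))
  where open +-*-Solver

*-tight : ∀ x y {ε} → 0ℚ < ε → ∃₂ λ c c′ →
          (∃₂ λ a a′ → L x a × L y a′ × c ≡ a * a′) ×
          (∃₂ λ b b′ → U x b × U y b′ × c′ ≡ b * b′) × c′ ≤ c + ε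
*-tight x y {ε} 0<ε =
  let _ , B , _ , UB , _ = tight x (positive⁻¹ 1ℚ)
      _ , C , _ , UC , _ = tight y (positive⁻¹ 1ℚ)
      δ , 0<δ , δ≤1 , δM≤ε =
        small {B + C + 1ℚ} (0≤+ {B + C} (0≤+ {B} (U-nonNeg x UB) (U-nonNeg y UC)) 0≤1) 0<ε
      a , b , La , Ub , b≤ = tight x 0<δ
      a′ , b′ , La′ , Ub′ , b′≤ = tight y 0<δ
  in  a * a′ , b * b′ , (a , a′ , La , La′ , refl) , (b , b′ , Ub , Ub′ , refl) ,
      *-close {a} {b} {a′} {b′} {B} {C} {δ} (U-nonNeg x Ub) b≤ (U-nonNeg y Ub′) b′≤
        (ordered x La UB) (ordered y La′ UC) (<⇒≤ 0<δ) δ≤1 δM≤ε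

_*ᴿ_ : ℝ≥0 → ℝ≥0 → ℝ≥0
(x *ᴿ y) .L c = ∃₂ λ a a′ → L x a × L y a′ × c ≡ a * a′
(x *ᴿ y) .U c = ∃₂ λ b b′ → U x b × U y b′ × c ≡ b * b′
(x *ᴿ y) .nonNeg (_ , _ , La , La′ , refl) = 0≤* (nonNeg x La) (nonNeg y La′)
(x *ᴿ y) .ordered (_ , _ , La , La′ , refl) (_ , _ , Ub , Ub′ , refl) =
  *-mono-≤ (nonNeg x La) (ordered x La Ub) (nonNeg y La′) (ordered y La′ Ub′)
(x *ᴿ y) .tight 0<ε = *-tight x y 0<ε

_/ᴺ_ : ℝ≥0 → (k : ℕ) .{{_ : ℕ.NonZero k}} → ℝ≥0
x /ᴺ k = x *ᴿ ratio 1 k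

inverse : (y : ℝ≥0) → 0< y → ℝ≥0
inverse y 0<y .L c = 0ℚ ≤ c × ∃[ b ] U y b × c * b ≤ 1ℚ
inverse y 0<y .U c = 0ℚ ≤ c × ∃[ a ] L y a × 1ℚ ≤ c * a
inverse y 0<y .nonNeg = proj₁
inverse y 0<y@(p , Lp , 0<p) .ordered {c} {c′} (0≤c , b , Ub , cb≤1) (0≤c′ , a , La , 1≤c′a) =
  *-cancelˡ-≤-pos b (subst₂ _≤_ (*-comm c b) (*-comm c′ b)
    (≤-trans cb≤1 (≤-trans 1≤c′a (*-monoˡ-≤-nonNeg c′ {{nonNegative 0≤c′}} (ordered y La Ub)))))
  where instance
    posb : Positive b
    posb = positive (<-≤-trans 0<p (ordered y Lp Ub))
inverse y 0<y@(p , Lp , 0<p) .tight {ε} 0<ε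
  with a₀ , b , La₀ , Ub , b≤a₀+δ ← tight y (0<* 0<ε (0<* 0<p 0<p)) =
  1/ b , 1/ a ,
  (<⇒≤ 0<1/b , b , Ub , ≤-reflexive (*-inverseˡ b)) ,
  (<⇒≤ 0<1/a , a , La , ≤-reflexive (sym (*-inverseˡ a))) ,
  (begin
    1/ a                             ≡⟨ trans (cong (1/ a *_) (*-inverseʳ b)) (*-identityʳ (1/ a)) ⟨
    1/ a * (b * 1/ b)                ≤⟨ *-monoˡ-≤-nonNeg (1/ a) {{nonNegative (<⇒≤ 0<1/a)}}
                                          (*-monoʳ-≤-nonNeg (1/ b) {{nonNegative (<⇒≤ 0<1/b)}} b≤) ⟩
    1/ a * ((a + ε * (a * b)) * 1/ b) ≡⟨ solve 5 (λ a b i j e → i :* ((a :+ e :* (a :* b)) :* j) := (i :* a) :* (j :+ e :* (b :* j))) refl a b (1/ a) (1/ b) ε ⟩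
    (1/ a * a) * (1/ b + ε * (b * 1/ b)) ≡⟨ cong₂ (λ s t → s * (1/ b + ε * t)) (*-inverseˡ a) (*-inverseʳ b) ⟩
    1ℚ * (1/ b + ε * 1ℚ)             ≡⟨ solve 2 (λ j e → con 1ℚ :* (j :+ e :* con 1ℚ) := j :+ e) refl (1/ b) ε ⟩
    1/ b + ε                         ∎)
  where
  open ≤-Reasoning
  open +-*-Solver
  a = a₀ ⊔ p
  La : L y a
  La with ⊔-sel a₀ p
  ... | inj₁ eq = subst (L y) (sym eq) La₀
  ... | inj₂ eq = subst (L y) (sym eq) Lp
  p≤a : p ≤ a
  p≤a = p≤q⊔p a₀ p
  p≤b : p ≤ b
  p≤b = ordered y Lp Ub
  instance
    posa : Positive a
    posa = positive (<-≤-trans 0<p p≤a)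
    posb : Positive b
    posb = positive (<-≤-trans 0<p p≤b)
    nza : ℚ.NonZero a
    nza = pos⇒nonZero a
    nzb : ℚ.NonZero b
    nzb = pos⇒nonZero b
  0<1/a : 0ℚ < 1/ a
  0<1/a = positive⁻¹ (1/ a) {{1/pos⇒pos a}}
  0<1/b : 0ℚ < 1/ b
  0<1/b = positive⁻¹ (1/ b) {{1/pos⇒pos b}}
  b≤ : b ≤ a + ε * (a * b)
  b≤ = ≤-trans b≤a₀+δ (+-mono-≤ (p≤p⊔q a₀ p)
         (*-monoˡ-≤-nonNeg ε {{nonNegative (<⇒≤ 0<ε)}} (*-mono-≤ (<⇒≤ 0<p) p≤a (<⇒≤ 0<p) p≤b)))

1≤⇒0< : ∀ x → fromℕ 1 ≤ᴿ x → 0< x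
1≤⇒0< x 1≤x with a , b , La , Ub , b≤a+½ ← tight x (positive⁻¹ ℚ.½) with a ≤? 0ℚ
... | no  a≰0 = a , La , ≰⇒> a≰0
... | yes a≤0 = contradiction
  (≤-trans (1≤x refl Ub) (≤-trans b≤a+½ (+-monoˡ-≤ ℚ.½ a≤0)))
  (λ { (ℚ.*≤* (ℤ.+≤+ (ℕ.s≤s ()))) })

root : (k : ℕ) .{{_ : ℕ.NonZero k}} → ℕ → ℝ≥0
root k n .L a = 0ℚ ≤ a × a ^ k ≤ ℤ.+ n / 1
root k n .U b = 0ℚ ≤ b × ℤ.+ n / 1 ≤ b ^ k
root k n .nonNeg = proj₁
root k n .ordered {a} {b} (0≤a , a^k≤n) (0≤b , n≤b^k) with a ≤? b
... | yes a≤b = a≤b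
... | no  a≰b = contradiction
  (<-≤-trans (^-mono-< k 0≤b (≰⇒> a≰b)) (≤-trans a^k≤n n≤b^k)) (<-irrefl refl)
root k n .tight {ε} 0<ε = search (proj₁ fuel) ≤-refl (≤-trans (0^k≤0 k) (0≤/ n 1)) enough
  where
  n′ = ℤ.+ n / 1
  0≤ε = <⇒≤ 0<ε
  instance
    posε : Positive ε
    posε = positive 0<ε
    nzε : ℚ.NonZero ε
    nzε = pos⇒nonZero ε
  search : ∀ m {a} → 0ℚ ≤ a → a ^ k ≤ n′ → n′ ≤ (a + ℤ.+ m / 1 * ε) ^ k →
           ∃₂ λ a b → (0ℚ ≤ a × a ^ k ≤ n′) × (0ℚ ≤ b × n′ ≤ b ^ k) × b ≤ a + ε
  search zero {a} 0≤a a^k≤n n≤ =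
    a , a , (0≤a , a^k≤n) ,
    (0≤a , subst (λ z → n′ ≤ z ^ k) (trans (cong (a +_) (*-zeroˡ ε)) (+-identityʳ a)) n≤) ,
    p≤p+q 0≤ε
  search (suc m) {a} 0≤a a^k≤n n≤ with (a + ε) ^ k ≤? n′
  ... | yes le = search m (0≤+ 0≤a 0≤ε) le (subst (λ z → n′ ≤ z ^ k)
          (trans (cong (λ z → a + z * ε) (suc/1 m))
                 (solve 3 (λ a m ε → a :+ (con 1ℚ :+ m) :* ε := (a :+ ε) :+ m :* ε) refl a (ℤ.+ m / 1) ε)) n≤)
    where open +-*-Solver
  ... | no ¬le =
    a , a + ε , (0≤a , a^k≤n) , (0≤+ 0≤a 0≤ε , <⇒≤ (≰⇒> ¬le)) , ≤-refl
  q = 1ℚ + n′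
  1≤q : 1ℚ ≤ q
  1≤q = p≤p+q (0≤/ n 1)
  n≤q : n′ ≤ q
  n≤q = ≤-trans (≤-reflexive (sym (+-identityˡ n′))) (+-monoˡ-≤ n′ 0≤1)
  fuel : ∃[ m ] q * 1/ ε ≤ ℤ.+ m / 1
  fuel = bound (q * 1/ ε)
  q≤ : q ≤ 0ℚ + ℤ.+ proj₁ fuel / 1 * ε
  q≤ = begin
    q                           ≡⟨ trans (*-assoc q (1/ ε) ε) (trans (cong (q *_) (*-inverseˡ ε)) (*-identityʳ q)) ⟨
    q * 1/ ε * ε                ≤⟨ *-monoʳ-≤-nonNeg ε {{nonNegative 0≤ε}} (proj₂ fuel) ⟩
    ℤ.+ proj₁ fuel / 1 * ε      ≡⟨ +-identityˡ _ ⟨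
    0ℚ + ℤ.+ proj₁ fuel / 1 * ε ∎
    where open ≤-Reasoning
  enough : n′ ≤ (0ℚ + ℤ.+ proj₁ fuel / 1 * ε) ^ k
  enough = ≤-trans n≤q (≤-trans (p≤p^k k 1≤q) (^-mono-≤ k (≤-trans 0≤1 1≤q) q≤))

_^1+1/_ : ℕ → (k : ℕ) .{{_ : ℕ.NonZero k}} → ℝ≥0
n ^1+1/ k = fromℕ n *ᴿ root k n

PairSet : ℕ → Set
PairSet n = Fin n × Fin n → Bool

∣_∣ₚ : ∀ {n} → PairSet n → ℕ
∣_∣ₚ {n} P = length (filterᵇ P (cartesianProduct (allFin n) (allFin n)))

record Graph (n : ℕ) : Set where
  field
    adj       : PairSet n
    symmetric : ∀ u v → adj (u , v) ≡ adj (v , u)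
    loopless  : ∀ v → adj (v , v) ≡ false

open Graph

-- Each undirected edge is counted once, as the pair with u < v.
∣E_∣ : ∀ {n} → Graph n → ℕ
∣E G ∣ = ∣ (λ (u , v) → ⌊ u <? v ⌋ ∧ adj G (u , v)) ∣ₚ

_⊆ᴳ_ : ∀ {n} → Graph n → Graph n → Set
S ⊆ᴳ G = ∀ u v → T (adj S (u , v)) → T (adj G (u , v))

data Walk {n} (G : Graph n) : Fin n → Fin n → ℕ → Set where
  []  : ∀ {u} → Walk G u u 0
  _∷_ : ∀ {u v w ℓ} → T (adj G (u , v)) → Walk G v w ℓ → Walk G u w (suc ℓ)

-- d_G(u,v) = d.  No d satisfies this if u and v are not connected, that is, if
-- the distance is infinite.
Distance : ∀ {n} → Graph n → Fin n → Fin n → ℕ → Set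
Distance G u v d = Walk G u v d × (∀ ℓ → Walk G u v ℓ → d ℕ.≤ ℓ)

-- d_S(u,v) ≤ α · d_G(u,v), which is trivial if d_G(u,v) is infinite.
StretchAtMost : ∀ {n} → ℝ≥0 → (G S : Graph n) → Fin n → Fin n → Set
StretchAtMost α G S u v =
  ∀ d → Distance G u v d → ∃[ d′ ] Distance S u v d′ × fromℕ d′ ≤ᴿ α *ᴿ fromℕ d

IsPairwiseSpanner : ∀ {n} → ℝ≥0 → PairSet n → (G S : Graph n) → Set
IsPairwiseSpanner α P G S =
  S ⊆ᴳ G × (∀ u v → T (P (u , v)) → StretchAtMost α G S u v)

overhead : ∀ {n} (P : PairSet n) .{{_ : ℕ.NonZero ∣ P ∣ₚ}} → Graph n → ℝ≥0
overhead P S = ratio ∣E S ∣ ∣ P ∣ₚ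

{-# OPTIONS --safe #-}

-- Let d = ⌊n^(1/k)⌋ and t = ⌊d/2⌋, and grow a single trail v₀ v₁ v₂ … in which
-- every new edge joins vertices at distance at least k in the graph so far and
-- no vertex is visited more than t times.  The graph then has girth greater than
-- k and maximum degree at most 2t, so for t ≥ 2 its balls of radius k - 1 hold
-- fewer than n/3 vertices, while for t = 1 any unvisited vertex is far enough.
-- Hence the trail can be grown to about tn/2 edges.  Cut it into segments of
-- ℓ ≈ k/(α + 1) edges, where ℓ(α + 1) ≤ k, and let P consist of the pairs of
-- their ends.  A detour between the ends of a segment that avoids one of its
-- edges has more than k - ℓ ≥ αℓ edges, so an α-spanner keeps every edge of
-- every segment, that is, ℓ edges for each pair of P.
module Submission where

open import Data.Product.Base using (Σ-syntax; ∃-syntax; ∃₂; _×_; _,_; proj₁; proj₂)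
open import Relation.Binary.PropositionalEquality hiding ([_])
open import Relation.Nullary using (¬_; Dec; yes; no; contradiction)

module Combinatorics where

  open import Data.Bool.Base using (T)
  open import Data.Bool.Properties using (T-∧; T?)
  open import Data.Empty using (⊥-elim)
  open import Data.Fin.Base using (Fin)
  open import Data.Fin.Properties using (_≟_; _<?_; any?; ¬∀⟶∃¬)
  import Data.Fin.Properties as Finₚ
  open import Data.List.Base
    using (List; []; _∷_; _++_; length; map; filter; concat; concatMap; replicate; allFin; cartesianProduct)
  open import Data.List.Properties using (length-++; length-map; length-++-sucʳ; ++-assoc; length-tabulate)
  import Data.List.Membership.DecPropositional as DecMembership
  open import Data.List.Membership.Propositional using (_∈_; _∉_; lose)
  open import Data.List.Membership.Propositional.Properties
  open import Data.List.Relation.Unary.All as All using (All; []; _∷_)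
  open import Data.List.Relation.Unary.AllPairs using ([]; _∷_)
  open import Data.List.Relation.Unary.Any using (here; there)
  open import Data.List.Relation.Unary.Unique.Propositional using (Unique)
  import Data.List.Relation.Unary.Unique.Propositional.Properties as Uniqueₚ
  open import Data.Nat.Base using (ℕ; zero; suc; pred; >-nonZero; _+_; _*_; _^_; _<_; _≤_; z≤n; s≤s)
  open import Data.Nat.Properties hiding (_≟_; _<?_)
  open import Data.Nat.Solver using (module +-*-Solver)
  open import Data.Product.Base using () renaming (swap to swapₚ)
  open import Data.Product.Properties using (≡-dec)
  open import Data.Sum.Base using (_⊎_; inj₁; inj₂; swap; [_,_]′)
  open import Function.Base using (_∘_)
  open import Function.Bundles using (module Equivalence)
  open import Relation.Binary.Definitions using (DecidableEquality)
  open import Relation.Nullary.Decidable using (¬?; _×-dec_; _⊎-dec_; ⌊_⌋; toWitness; fromWitness)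
  open import Defs using (PairSet; ∣_∣ₚ; Graph; ∣E_∣; _⊆ᴳ_; Walk; Distance; []; _∷_)
  open Graph

  -- Least witnesses and comparison of list lengths.

  least : ∀ {P : ℕ → Set} → (∀ j → Dec (P j)) → ∀ m → P m → ∃[ d ] d ≤ m × P d × (∀ j → P j → d ≤ j)
  least P? m p with P? 0
  ... | yes p₀ = 0 , z≤n , p₀ , λ _ _ → z≤n
  least P? zero    p | no ¬p₀ = contradiction p ¬p₀
  least P? (suc m) p | no ¬p₀ with d , d≤m , pd , min ← least (P? ∘ suc) m p =
    suc d , s≤s d≤m , pd , λ { zero p₀ → contradiction p₀ ¬p₀ ; (suc j) pj → s≤s (min j pj) }

  module _ {A : Set} where

    ∈-delete : ∀ {z x : A} as {bs} → z ∈ as ++ x ∷ bs → z ≢ x → z ∈ as ++ bs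
    ∈-delete as z∈ z≢x with ∈-++⁻ as z∈
    ... | inj₁ z∈as         = ∈-++⁺ˡ z∈as
    ... | inj₂ (here z≡x)   = contradiction z≡x z≢x
    ... | inj₂ (there z∈bs) = ∈-++⁺ʳ as z∈bs

    Unique-⊆⇒length-≤ : ∀ {xs ys : List A} → Unique xs → (∀ {x} → x ∈ xs → x ∈ ys) →
                        length xs ≤ length ys
    Unique-⊆⇒length-≤ [] xs⊆ys = z≤n
    Unique-⊆⇒length-≤ {x ∷ xs} {ys} (x∉ ∷ u) xs⊆ys with as , bs , refl ← ∈-∃++ (xs⊆ys (here refl)) =
      subst (suc (length xs) ≤_) (sym (length-++-sucʳ as x bs))
        (s≤s (Unique-⊆⇒length-≤ u λ z∈ → ∈-delete as (xs⊆ys (there z∈)) (All.lookup x∉ z∈ ∘ sym)))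

    ∈-insert⁺ : ∀ {z x : A} as {bs} → z ∈ as ++ bs → z ∈ as ++ x ∷ bs
    ∈-insert⁺ as z∈ with ∈-++⁻ as z∈
    ... | inj₁ z∈as = ∈-++⁺ˡ z∈as
    ... | inj₂ z∈bs = ∈-++⁺ʳ as (there z∈bs)

    *-length-concatMap-≤ : ∀ {B : Set} (f : A → List B) c b (xs : List A) →
                           (∀ x → c * length (f x) ≤ b) → c * length (concatMap f xs) ≤ length xs * b
    *-length-concatMap-≤ f c b []       fx≤b = ≤-reflexive (*-zeroʳ c)
    *-length-concatMap-≤ f c b (x ∷ xs) fx≤b = begin
      c * length (f x ++ concatMap f xs)             ≡⟨ cong (c *_) (length-++ (f x)) ⟩
      c * (length (f x) + length (concatMap f xs))   ≡⟨ *-distribˡ-+ c (length (f x)) _ ⟩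
      c * length (f x) + c * length (concatMap f xs) ≤⟨ +-mono-≤ (fx≤b x) (*-length-concatMap-≤ f c b xs fx≤b) ⟩
      b + length xs * b                              ∎
      where open ≤-Reasoning

    length-concat-replicate : ∀ t (xs : List A) → length (concat (replicate t xs)) ≡ t * length xs
    length-concat-replicate zero    xs = refl
    length-concat-replicate (suc t) xs = trans (length-++ xs) (cong (length xs +_) (length-concat-replicate t xs))

  -- Multiplicities and the pigeonhole principle.

  module Multiplicity {A : Set} (_≟_ : DecidableEquality A) where

    mult : A → List A → ℕ
    mult u xs = length (filter (u ≟_) xs)

    mult-++ : ∀ u xs ys → mult u (xs ++ ys) ≡ mult u xs + mult u ys
    mult-++ u []       ys = refl
    mult-++ u (x ∷ xs) ys with u ≟ x
    ... | yes _ = cong suc (mult-++ u xs ys)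
    ... | no  _ = mult-++ u xs ys

    mult-map : ∀ {B : Set} (f : B → A) u xs → length (filter ((u ≟_) ∘ f) xs) ≡ mult u (map f xs)
    mult-map f u []       = refl
    mult-map f u (x ∷ xs) with u ≟ f x
    ... | yes _ = cong suc (mult-map f u xs)
    ... | no  _ = mult-map f u xs

    mult-∷-mono : ∀ u x {xs ys} → mult u xs ≤ mult u ys → mult u (x ∷ xs) ≤ mult u (x ∷ ys)
    mult-∷-mono u x le with u ≟ x
    ... | yes _ = s≤s le
    ... | no  _ = le

    ∈⇒mult≥1 : ∀ {u xs} → u ∈ xs → 1 ≤ mult u xs
    ∈⇒mult≥1 {u} {x ∷ xs} u∈ with u ≟ x | u∈
    ... | yes _  | _          = s≤s z≤n
    ... | no u≢x | here u≡x   = contradiction u≡x u≢x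
    ... | no _   | there u∈xs = ∈⇒mult≥1 u∈xs

    ∈⇒mult-replicate : ∀ t {u xs} → u ∈ xs → t ≤ mult u (concat (replicate t xs))
    ∈⇒mult-replicate zero    u∈ = z≤n
    ∈⇒mult-replicate (suc t) {u} {xs} u∈ = subst (suc t ≤_)
      (sym (mult-++ u xs _)) (+-mono-≤ (∈⇒mult≥1 u∈) (∈⇒mult-replicate t u∈))

    split-mult : ∀ u xs → length xs ≡ mult u xs + length (filter (¬? ∘ (u ≟_)) xs)
    split-mult u []       = refl
    split-mult u (x ∷ xs) with u ≟ x
    ... | yes _ = cong suc (split-mult u xs)
    ... | no  _ = trans (cong suc (split-mult u xs)) (sym (+-suc _ _))

    mult-filter-≢ : ∀ {u v} xs → u ≢ v → mult v (filter (¬? ∘ (u ≟_)) xs) ≡ mult v xs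
    mult-filter-≢ []       u≢v = refl
    mult-filter-≢ {u} {v} (x ∷ xs) u≢v with u ≟ x
    mult-filter-≢ {u} {v} (x ∷ xs) u≢v | yes refl with v ≟ x
    ... | yes v≡x = contradiction (sym v≡x) u≢v
    ... | no  _   = mult-filter-≢ xs u≢v
    mult-filter-≢ {u} {v} (x ∷ xs) u≢v | no _ with v ≟ x
    ... | yes _ = cong suc (mult-filter-≢ xs u≢v)
    ... | no  _ = mult-filter-≢ xs u≢v

    -- Deleting every copy of `u` shortens `xs` by at least `t` and leaves the multiplicities of the
    -- remaining members of `us`, which differ from `u`, unchanged.
    pigeonhole : ∀ t {us} xs → Unique us → All (λ u → t ≤ mult u xs) us →
                 length us * t ≤ length xs
    pigeonhole t xs []       []       = z≤n
    pigeonhole t {u ∷ us} xs (u∉ ∷ uq) (t≤ ∷ ts) = subst (t + length us * t ≤_) (sym (split-mult u xs))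
      (+-mono-≤ t≤ (pigeonhole t (filter (¬? ∘ (u ≟_)) xs) uq
        (All.map (λ (t≤ , u≢v) → subst (t ≤_) (sym (mult-filter-≢ xs u≢v)) t≤) (All.zip (ts , u∉)))))

  module Greedy {n : ℕ} where

    open Multiplicity (_≟_ {n}) public

    ∃-rare : ∀ t xs → length xs < n * t → ∃[ u ] mult u xs < t
    ∃-rare t xs lt with ¬∀⟶∃¬ n (λ u → t ≤ mult u xs) (λ u → t ≤? mult u xs) ¬all
      where
      ¬all : ¬ (∀ u → t ≤ mult u xs)
      ¬all all = <⇒≱ lt (subst (λ l → l * t ≤ length xs) (length-tabulate {n = n} (λ i → i))
        (pigeonhole t xs (Uniqueₚ.allFin⁺ n) (All.universal all (allFin n))))
    ... | u , t≰ = u , ≰⇒> t≰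

    -- Walks over a growing list of edges.

    V = Fin n
    Edges = List (V × V)

    Adj : Edges → V → V → Set
    Adj es u v = (u , v) ∈ es ⊎ (v , u) ∈ es

    infixr 5 _∷_

    -- Walks are taken over an edge list instead of a `Graph` because the construction adds one edge
    -- at a time and the girth arguments are inductions on the newest edge.
    data EdgeWalk (es : Edges) : V → V → ℕ → Set where
      []  : ∀ {u} → EdgeWalk es u u 0
      _∷_ : ∀ {u v w ℓ} → Adj es u v → EdgeWalk es v w ℓ → EdgeWalk es u w (suc ℓ)

    module _ {es : Edges} where

      infixr 5 _⊹_

      _⊹_ : ∀ {u v w p q} → EdgeWalk es u v p → EdgeWalk es v w q → EdgeWalk es u w (p + q)
      []       ⊹ ws′ = ws′
      (e ∷ ws) ⊹ ws′ = e ∷ (ws ⊹ ws′)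

      reverse : ∀ {u v p} → EdgeWalk es u v p → EdgeWalk es v u p
      reverse []       = []
      reverse {p = suc p} (e ∷ ws) =
        subst (EdgeWalk es _ _) (+-comm p 1) (reverse ws ⊹ swap e ∷ [])

    Adj-mono : ∀ {es fs : Edges} → (∀ {e} → e ∈ es → e ∈ fs) → ∀ {u v} → Adj es u v → Adj fs u v
    Adj-mono es⊆fs (inj₁ e) = inj₁ (es⊆fs e)
    Adj-mono es⊆fs (inj₂ e) = inj₂ (es⊆fs e)

    EdgeWalk-mono : ∀ {es fs : Edges} → (∀ {e} → e ∈ es → e ∈ fs) →
                    ∀ {u v p} → EdgeWalk es u v p → EdgeWalk fs u v p
    EdgeWalk-mono es⊆fs []       = []
    EdgeWalk-mono es⊆fs (e ∷ ws) = Adj-mono es⊆fs e ∷ EdgeWalk-mono es⊆fs ws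

    -- In the last two cases `ab` is crossed once, from `a` to `b` or from `b` to `a`. That crossing
    -- belongs to neither piece, whence the strict inequality.
    data Decomposition (es : Edges) (a b u w : V) (ℓ : ℕ) : Set where
      avoiding : ∀ {p} → EdgeWalk es u w p → p ≤ ℓ → Decomposition es a b u w ℓ
      forward  : ∀ {p q} → EdgeWalk es u a p → EdgeWalk es b w q → p + q < ℓ → Decomposition es a b u w ℓ
      backward : ∀ {p q} → EdgeWalk es u b p → EdgeWalk es a w q → p + q < ℓ → Decomposition es a b u w ℓ

    prepend : ∀ {es a b u v w ℓ} → Adj es u v → Decomposition es a b v w ℓ → Decomposition es a b u w (suc ℓ)
    prepend e (avoiding ws p≤)     = avoiding (e ∷ ws) (s≤s p≤)
    prepend e (forward ws ws′ lt)  = forward (e ∷ ws) ws′ (s≤s lt)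
    prepend e (backward ws ws′ lt) = backward (e ∷ ws) ws′ (s≤s lt)

    -- Cutting out everything between the first and the last use of the edge ab
    -- leaves a walk that uses it at most once.
    decompose : ∀ {es a b u w ℓ} → EdgeWalk ((a , b) ∷ es) u w ℓ → Decomposition es a b u w ℓ
    decompose [] = avoiding [] z≤n
    decompose (inj₁ (here refl) ∷ ws) with decompose ws
    ... | avoiding ws′ p≤       = forward [] ws′ (s≤s p≤)
    ... | forward {p} _ ws′ lt  = forward [] ws′ (s≤s (≤-trans (m≤n+m _ p) (<⇒≤ lt)))
    ... | backward {p} _ ws′ lt = avoiding ws′ (m≤n⇒m≤1+n (≤-trans (m≤n+m _ p) (<⇒≤ lt)))
    decompose (inj₂ (here refl) ∷ ws) with decompose ws
    ... | avoiding ws′ p≤       = backward [] ws′ (s≤s p≤)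
    ... | forward {p} _ ws′ lt  = avoiding ws′ (m≤n⇒m≤1+n (≤-trans (m≤n+m _ p) (<⇒≤ lt)))
    ... | backward {p} _ ws′ lt = backward [] ws′ (s≤s (≤-trans (m≤n+m _ p) (<⇒≤ lt)))
    decompose (inj₁ (there e) ∷ ws) = prepend (inj₁ e) (decompose ws)
    decompose (inj₂ (there e) ∷ ws) = prepend (inj₂ e) (decompose ws)

    -- Edge lists of high girth.

    module _ (k : ℕ) where

      -- Edges are listed newest first, and each one joins two vertices at
      -- distance at least k in the graph of the older ones.
      data HighGirth : Edges → Set where
        []  : HighGirth []
        _∷_ : ∀ {x y es} → (∀ {ℓ} → ℓ < k → ¬ EdgeWalk es x y ℓ) →
              HighGirth es → HighGirth ((x , y) ∷ es)

      ++⁻ʳ : ∀ es {fs} → HighGirth (es ++ fs) → HighGirth fs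
      ++⁻ʳ []       hg       = hg
      ++⁻ʳ (_ ∷ es) (_ ∷ hg) = ++⁻ʳ es hg

      -- `HighGirth` compares an edge with older ones only; here newer edges are present too. If the
      -- short walk crosses the newest edge, its two pieces together with `xy` join the ends of that
      -- edge by a walk of length `p + q + 1 ≤ ℓ < k` over older edges, so that edge could not have
      -- been added.
      no-short-cycle : ∀ es {x y fs} → HighGirth (es ++ (x , y) ∷ fs) →
                       ∀ {ℓ} → ℓ < k → ¬ EdgeWalk (es ++ fs) x y ℓ
      no-short-cycle []       (far ∷ _) ℓ<k ws = far ℓ<k ws
      no-short-cycle (f ∷ es) {x} {y} {fs} (far ∷ hg) {ℓ} ℓ<k ws with decompose ws
      ... | avoiding ws′ p≤ℓ = no-short-cycle es hg (≤-<-trans p≤ℓ ℓ<k) ws′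
      ... | forward {p} {q} ws₁ ws₂ p+q<ℓ = far
          (subst (_< k) (sym (+-suc p q)) (≤-<-trans p+q<ℓ ℓ<k))
          (EdgeWalk-mono (∈-insert⁺ es) (reverse ws₁) ⊹ inj₁ (∈-++⁺ʳ es (here refl)) ∷
           EdgeWalk-mono (∈-insert⁺ es) (reverse ws₂))
      ... | backward {p} {q} ws₁ ws₂ p+q<ℓ = far
          (subst (_< k) (trans (cong suc (+-comm p q)) (sym (+-suc q p))) (≤-<-trans p+q<ℓ ℓ<k))
          (EdgeWalk-mono (∈-insert⁺ es) ws₂ ⊹ inj₂ (∈-++⁺ʳ es (here refl)) ∷
           EdgeWalk-mono (∈-insert⁺ es) ws₁)

      no-loop : 0 < k → ∀ {es} → HighGirth es → ∀ {v} → (v , v) ∉ es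
      no-loop 0<k (far ∷ hg) (here refl) = far 0<k []
      no-loop 0<k (far ∷ hg) (there e)   = no-loop 0<k hg e

      -- Cutting the trail into segments.

      data Segment : V → V → Edges → Set where
        [] : ∀ {u} → Segment u u []
        ∷_ : ∀ {w u v es} → Segment u v es → Segment w v ((w , u) ∷ es)

      segment-walk : ∀ {u v es fs} → (∀ {e} → e ∈ es → e ∈ fs) → Segment u v es → EdgeWalk fs u v (length es)
      segment-walk es⊆fs []    = []
      segment-walk es⊆fs (∷ s) = inj₁ (es⊆fs (here refl)) ∷ segment-walk (es⊆fs ∘ there) s

      data Chopped (ℓ : ℕ) : V → Edges → List (V × V) → Set where
        []   : ∀ {v} → Chopped ℓ v [] []
        cons : ∀ {u v es fs ps} → Segment u v es → length es ≡ ℓ → Chopped ℓ v fs ps →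
               Chopped ℓ u (es ++ fs) ((u , v) ∷ ps)

      segment-of-pair : ∀ {ℓ w es ps} → Chopped ℓ w es ps → ∀ {u v} → (u , v) ∈ ps →
        ∃[ as ] ∃[ bs ] ∃[ cs ] es ≡ as ++ bs ++ cs × Segment u v bs × length bs ≡ ℓ
      segment-of-pair (cons {es = es} {fs} s len c) (here refl) = [] , es , fs , refl , s , len
      segment-of-pair (cons {es = es} s len c) (there p∈)
        with as , bs , cs , refl , s′ , len′ ← segment-of-pair c p∈ =
        es ++ as , bs , cs , sym (++-assoc es as (bs ++ cs)) , s′ , len′

      segment-of-edge : ∀ {ℓ w es ps} → Chopped ℓ w es ps → ∀ {e} → e ∈ es →
        ∃[ as ] ∃[ bs ] ∃[ cs ] ∃[ u ] ∃[ v ]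
        (u , v) ∈ ps × es ≡ as ++ bs ++ cs × Segment u v bs × length bs ≡ ℓ × e ∈ bs
      segment-of-edge (cons {es = es} {fs} s len c) e∈ with ∈-++⁻ es e∈
      ... | inj₁ e∈es = [] , es , fs , _ , _ , here refl , refl , s , len , e∈es
      ... | inj₂ e∈fs with as , bs , cs , u , v , p∈ , refl , s′ , len′ , e∈′ ← segment-of-edge c e∈fs =
        es ++ as , bs , cs , u , v , there p∈ , sym (++-assoc es as (bs ++ cs)) , s′ , len′ , e∈′

      -- Two segments with the same ends form a closed walk of `2 * ℓ ≤ k` edges. Without its newest
      -- edge, `2 * ℓ - 1 < k` older ones still join the ends of that edge, against `HighGirth`.
      -- Hence there are as many pairs as segments.
      endpoints-unique : ∀ {ℓ w es ps} → 0 < ℓ → ℓ + ℓ ≤ k → HighGirth es → Chopped ℓ w es ps → Unique ps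
      endpoints-unique 0<ℓ 2ℓ≤k hg [] = []
      endpoints-unique 0<ℓ 2ℓ≤k hg (cons {u} {v} {es} {ps = ps} s len c) =
        All.tabulate (λ { p∈ refl → ∉ps p∈ }) ∷ endpoints-unique 0<ℓ 2ℓ≤k (++⁻ʳ es hg) c
        where
        clash : ∀ {ℓ u v es fs as bs cs} → fs ≡ as ++ bs ++ cs → ℓ + ℓ ≤ k → 0 < ℓ → HighGirth (es ++ fs) →
                Segment u v es → length es ≡ ℓ → ¬ (Segment u v bs × length bs ≡ ℓ)
        clash refl 2ℓ≤k () hg [] refl (s′ , len′)
        clash {es = _ ∷ es} {as = as} {bs} {cs} refl 2ℓ≤k 0<ℓ (far ∷ hg) (∷ s) refl (s′ , len′) =
          far (≤-trans (s≤s (≤-reflexive (trans (cong (_+ length es) len′) (+-comm _ (length es))))) 2ℓ≤k)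
            (segment-walk (∈-++⁺ʳ es ∘ ∈-++⁺ʳ as ∘ ∈-++⁺ˡ) s′ ⊹ reverse (segment-walk ∈-++⁺ˡ s))
        ∉ps : (u , v) ∉ ps
        ∉ps p∈ with as , bs , cs , eq , s′ , len′ ← segment-of-pair c p∈ =
          clash {as = as} eq 2ℓ≤k 0<ℓ hg s len (s′ , len′)

      -- Subgraphs with short detours keep whole segments.

      module _ (S : Graph n) where

        symm : ∀ {u v} → T (adj S (u , v)) → T (adj S (v , u))
        symm {u} {v} = subst T (symmetric S u v)

        avoid : ∀ {es x y fs} → (∀ {u v} → T (adj S (u , v)) → Adj (es ++ (x , y) ∷ fs) u v) →
                ¬ T (adj S (x , y)) → ∀ {u v ℓ} → Walk S u v ℓ → EdgeWalk (es ++ fs) u v ℓ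
        avoid S⊆ ¬xy []       = []
        avoid {es} S⊆ ¬xy (e ∷ ws) with S⊆ e
        ... | inj₁ e∈ = inj₁ (∈-delete es e∈ λ { refl → ¬xy e }) ∷ avoid S⊆ ¬xy ws
        ... | inj₂ e∈ = inj₂ (∈-delete es e∈ λ { refl → ¬xy (symm e) }) ∷ avoid S⊆ ¬xy ws

        -- A walk of S with the same ends as the segment would close a short cycle
        -- through the first edge of the segment if S missed that edge.
        detour-keeps-segment : ∀ as {bs cs u v d} → HighGirth (as ++ bs ++ cs) →
          (∀ {u v} → T (adj S (u , v)) → Adj (as ++ bs ++ cs) u v) →
          Segment u v bs → Walk S u v d → d + length bs ≤ k →
          ∀ {x y} → (x , y) ∈ bs → T (adj S (x , y))
        detour-keeps-segment as {(w , s) ∷ bs} {cs} {d = d} hg S⊆ (∷ seg) ws d≤ e∈ with T? (adj S (w , s)) | e∈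
        ... | yes ws∈S | here refl  = ws∈S
        -- The edge just found in `S`, traversed backwards, makes the detour one longer, while the
        -- rest of the segment is one shorter: the sum bounded by `k` stays the same.
        ... | yes ws∈S | there e∈bs = detour-keeps-segment (as ++ (w , s) ∷ [])
                (subst HighGirth (sym (++-assoc as _ _)) hg)
                (λ e → subst (λ es → Adj es _ _) (sym (++-assoc as _ _)) (S⊆ e))
                seg (symm ws∈S ∷ ws) (≤-trans (≤-reflexive (sym (+-suc d _))) d≤) e∈bs
        ... | no  ws∉S | _ = ⊥-elim (no-short-cycle as hg (≤-trans (≤-reflexive (sym (+-suc d _))) d≤)
                (avoid S⊆ ws∉S ws ⊹ reverse (segment-walk (∈-++⁺ʳ as ∘ ∈-++⁺ˡ) seg)))

        private
          ordered : V × V → V × V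
          ordered (u , v) with u <? v
          ... | yes _ = u , v
          ... | no  _ = v , u

          ordered-≡ : ∀ {x y u v} → ordered (x , y) ≡ ordered (u , v) → (x , y) ≡ (u , v) ⊎ (y , x) ≡ (u , v)
          ordered-≡ {x} {y} {u} {v} eq with x <? y | u <? v
          ... | yes _ | yes _ = inj₁ eq
          ... | yes _ | no  _ = inj₂ (cong swapₚ eq)
          ... | no  _ | yes _ = inj₂ eq
          ... | no  _ | no  _ = inj₁ (cong swapₚ eq)

          -- A repeated edge, in either orientation, would be a walk of length 1 between vertices at
          -- distance at least `k > 1`. Ordering the ends matches the convention of `∣E_∣`.
          ordered-unique : 1 < k → ∀ {es} → HighGirth es → Unique (map ordered es)
          ordered-unique 1<k [] = []
          ordered-unique 1<k {(x , y) ∷ es} (far ∷ hg) = All.tabulate new ∷ ordered-unique 1<k hg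
            where
            new : ∀ {e} → e ∈ map ordered es → ordered (x , y) ≢ e
            new e∈ eq with (u , v) , uv∈ , refl ← ∈-map⁻ ordered e∈ with ordered-≡ {x} {y} {u} {v} eq
            ... | inj₁ refl = far 1<k (inj₁ uv∈ ∷ [])
            ... | inj₂ refl = far 1<k (inj₂ uv∈ ∷ [])

        length≤∣E∣ : 1 < k → ∀ {es} → HighGirth es → (∀ {x y} → (x , y) ∈ es → T (adj S (x , y))) →
                     length es ≤ ∣E S ∣
        length≤∣E∣ 1<k {es} hg es⊆S = subst (_≤ ∣E S ∣) (length-map ordered es)
          (Unique-⊆⇒length-≤ (ordered-unique 1<k hg) counted)
          where
          counted : ∀ {e} → e ∈ map ordered es → e ∈ _
          counted e∈ with (u , v) , uv∈ , refl ← ∈-map⁻ ordered e∈ with u <? v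
          ... | yes u<v = ∈-filter⁺ _ (∈-cartesianProduct⁺ (∈-allFin u) (∈-allFin v))
                            (Equivalence.from T-∧ (fromWitness u<v , es⊆S uv∈))
          ... | no  u≮v = ∈-filter⁺ _ (∈-cartesianProduct⁺ (∈-allFin v) (∈-allFin u))
                            (Equivalence.from T-∧ (fromWitness (Finₚ.≤∧≢⇒< (≮⇒≥ u≮v) v≢u) , symm (es⊆S uv∈)))
            where
            v≢u : v ≢ u
            v≢u refl = no-loop (<⇒≤ 1<k) hg uv∈

    -- From lists to graphs, pair sets and distances.

    _≟ₑ_ : DecidableEquality (V × V)
    _≟ₑ_ = ≡-dec _≟_ _≟_

    open DecMembership _≟ₑ_ using (_∈?_)

    adj? : ∀ es u v → Dec (Adj es u v)
    adj? es u v = ((u , v) ∈? es) ⊎-dec ((v , u) ∈? es)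

    toGraph : ∀ es → (∀ {v} → (v , v) ∉ es) → Graph n
    toGraph es loopfree .adj (u , v) = ⌊ adj? es u v ⌋
    toGraph es loopfree .symmetric u v with adj? es u v | adj? es v u
    ... | yes _ | yes _ = refl
    ... | no  _ | no  _ = refl
    ... | yes e | no ¬e = contradiction (swap e) ¬e
    ... | no ¬e | yes e = contradiction (swap e) ¬e
    toGraph es loopfree .loopless v with adj? es v v
    ... | yes e = ⊥-elim ([ loopfree , loopfree ]′ e)
    ... | no _  = refl

    module _ {es : Edges} {loopfree : ∀ {v} → (v , v) ∉ es} where

      toGraph⁻ : ∀ {u v} → T (adj (toGraph es loopfree) (u , v)) → Adj es u v
      toGraph⁻ = toWitness

      toGraph-walk : ∀ {u v ℓ} → EdgeWalk es u v ℓ → Walk (toGraph es loopfree) u v ℓ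
      toGraph-walk []       = []
      toGraph-walk (e ∷ ws) = fromWitness e ∷ toGraph-walk ws

    toPairSet : List (V × V) → PairSet n
    toPairSet ps p = ⌊ p ∈? ps ⌋

    toPairSet⁻ : ∀ {ps p} → T (toPairSet ps p) → p ∈ ps
    toPairSet⁻ {ps} {p} = toWitness {a? = p ∈? ps}

    toPairSet⁺ : ∀ {ps p} → p ∈ ps → T (toPairSet ps p)
    toPairSet⁺ {ps} {p} = fromWitness {a? = p ∈? ps}

    ∣toPairSet∣ : ∀ {ps} → Unique ps → ∣ toPairSet ps ∣ₚ ≡ length ps
    ∣toPairSet∣ {ps} uq = ≤-antisym
      (Unique-⊆⇒length-≤
        (Uniqueₚ.filter⁺ (T? ∘ toPairSet ps) (Uniqueₚ.cartesianProduct⁺ (Uniqueₚ.allFin⁺ n) (Uniqueₚ.allFin⁺ n)))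
        (λ e∈ → toPairSet⁻ {ps}
          (proj₂ (∈-filter⁻ (T? ∘ toPairSet ps) {xs = cartesianProduct (allFin n) (allFin n)} e∈))))
      (Unique-⊆⇒length-≤ uq (λ {(u , v)} e∈ → ∈-filter⁺ (T? ∘ toPairSet ps)
        (∈-cartesianProduct⁺ (∈-allFin u) (∈-allFin v)) (toPairSet⁺ {ps} e∈)))

    walk? : ∀ (G : Graph n) u v ℓ → Dec (Walk G u v ℓ)
    walk? G u v zero with u ≟ v
    ... | yes refl = yes []
    ... | no  u≢v  = no λ { [] → u≢v refl }
    walk? G u v (suc ℓ) with any? (λ w → T? (adj G (u , w)) ×-dec walk? G w v ℓ)
    ... | yes (w , e , ws) = yes (e ∷ ws)
    ... | no  ¬∃           = no λ { (e ∷ ws) → ¬∃ (_ , e , ws) }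

    -- `StretchAtMost` speaks of exact distances, while a segment supplies just some walk. Walks of
    -- a given length are decidable, so a shortest one can be searched for.
    distance-≤ : ∀ {G : Graph n} {u v ℓ} → Walk G u v ℓ → ∃[ d ] d ≤ ℓ × Distance G u v d
    distance-≤ {G} {u} {v} {ℓ} ws = least (walk? G u v) ℓ ws

    -- Degrees and the size of balls.

    neighbours : Edges → V → List V
    neighbours es v = map proj₂ (filter ((v ≟_) ∘ proj₁) es) ++ map proj₁ (filter ((v ≟_) ∘ proj₂) es)

    ∈-neighbours : ∀ {es u v} → Adj es u v → v ∈ neighbours es u
    ∈-neighbours {u = u} (inj₁ e) = ∈-++⁺ˡ (∈-map⁺ proj₂ (∈-filter⁺ ((u ≟_) ∘ proj₁) e refl))
    ∈-neighbours {u = u} (inj₂ e) = ∈-++⁺ʳ _ (∈-map⁺ proj₁ (∈-filter⁺ ((u ≟_) ∘ proj₂) e refl))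

    length-neighbours : ∀ es v → length (neighbours es v) ≡ mult v (map proj₁ es) + mult v (map proj₂ es)
    length-neighbours es v = trans (length-++ (map proj₂ (filter ((v ≟_) ∘ proj₁) es)))
      (cong₂ _+_ (trans (length-map proj₂ (filter ((v ≟_) ∘ proj₁) es)) (mult-map proj₁ v es))
                 (trans (length-map proj₁ (filter ((v ≟_) ∘ proj₂) es)) (mult-map proj₂ v es)))

    -- Repetitions are harmless: what matters is that the list covers the ball and is not too long.
    ball : Edges → ℕ → V → List V
    ball es zero    v = v ∷ []
    ball es (suc r) v = v ∷ concatMap (ball es r) (neighbours es v)

    ∈-ball : ∀ {es r u v ℓ} → ℓ ≤ r → EdgeWalk es u v ℓ → v ∈ ball es r u
    ∈-ball {r = zero}  ℓ≤r       []       = here refl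
    ∈-ball {r = suc r} ℓ≤r       []       = here refl
    ∈-ball {es} {suc r} (s≤s ℓ≤r) (e ∷ ws) =
      there (∈-concatMap⁺ (ball es r) (lose (∈-neighbours e) (∈-ball ℓ≤r ws)))

    -- The sum 1 + D + ... + D^r is less than D^(r+1)/(D - 1), and D - 1 is at least 3. In the
    -- induction, 4 ≤ D pays for the centre and for strictness: 4 + D(D^(r+1) - 1) ≤ D^(r+2).
    ball-size : ∀ {es D} → 4 ≤ D → (∀ v → length (neighbours es v) ≤ D) →
                ∀ r v → 3 * length (ball es r v) < D ^ suc r
    ball-size {D = D} 4≤D deg zero    v = subst (4 ≤_) (sym (*-identityʳ D)) 4≤D
    ball-size {es} {D} 4≤D deg (suc r) v = begin
      suc (3 * suc L)             ≡⟨ cong suc (*-suc 3 L) ⟩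
      4 + 3 * L                   ≤⟨ +-mono-≤ 4≤D 3L≤ ⟩
      D + D * pred (D ^ suc r)    ≡⟨ *-suc D (pred (D ^ suc r)) ⟨
      D * suc (pred (D ^ suc r))  ≡⟨ cong (D *_) (suc-pred (D ^ suc r)) ⟩
      D * D ^ suc r               ∎
      where
      open ≤-Reasoning
      instance _ = m^n≢0 D (suc r) {{>-nonZero (≤-trans (s≤s z≤n) 4≤D)}}
      L = length (concatMap (ball es r) (neighbours es v))
      3L≤ : 3 * L ≤ D * pred (D ^ suc r)
      3L≤ = ≤-trans (*-length-concatMap-≤ (ball es r) 3 (pred (D ^ suc r)) (neighbours es v)
                      (λ u → pred-mono-≤ (ball-size 4≤D deg r u)))
                    (*-monoˡ-≤ (pred (D ^ suc r)) (deg v))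

    end-of-walk : ∀ {es u v ℓ} → EdgeWalk es u v ℓ → u ≡ v ⊎ ∃[ w ] Adj es w v
    end-of-walk []       = inj₁ refl
    end-of-walk (e ∷ ws) with end-of-walk ws
    ... | inj₁ refl = inj₂ (_ , e)
    ... | inj₂ e′   = inj₂ e′

    -- Greedy growth of the trail.

    module _ (k t : ℕ) where

      -- An edge is listed with its newer end first, so these are all vertices of
      -- the trail that ends in v.
      visits : V → Edges → List V
      visits v es = v ∷ map proj₂ es

      -- The invariant of the greedy choice; that consecutive edges share a vertex is recorded by
      -- `Segment` and `Chopped`. A vertex is the newer end of at most `t` edges by `heads≤` and
      -- `visits≤`, and the older end of at most `t`, so its degree is at most `2 * t`.
      record Trail (v : V) (es : Edges) : Set where
        field
          girth   : HighGirth k es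
          heads≤  : ∀ u → mult u (map proj₁ es) ≤ mult u (visits v es)
          visits≤ : ∀ u → mult u (visits v es) ≤ t

      open Trail

      tails≤ : ∀ {v es} → Trail v es → ∀ u → mult u (map proj₂ es) ≤ t
      tails≤ {v} {es} tr u = ≤-trans mult-tail (visits≤ tr u)
        where
        mult-tail : mult u (map proj₂ es) ≤ mult u (visits v es)
        mult-tail with u ≟ v
        ... | yes _ = n≤1+n _
        ... | no  _ = ≤-refl

      -- `∃-rare` is applied to the visits together with `t` copies of `near`. A vertex occurring
      -- fewer than `t` times there is outside `near` and has a visit left, so it is far from `v`
      -- and can come next.
      extend : ∀ {v es} near → Trail v es →
               (∀ {u ℓ} → ℓ < k → EdgeWalk es v u ℓ → u ∈ near ⊎ t ≤ mult u (visits v es)) →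
               t * length near + suc (length es) < n * t → ∃[ w ] Trail w ((w , v) ∷ es)
      extend {v} {es} near tr near-or-full small with ∃-rare t (concat (replicate t near) ++ visits v es)
        (subst (_< n * t) (sym (trans (length-++ (concat (replicate t near)))
          (cong₂ _+_ (length-concat-replicate t near) (cong suc (length-map proj₂ es))))) small)
      ... | w , rare = w , record
        { girth   = far ∷ girth tr
        ; heads≤  = λ u → mult-∷-mono u w (heads≤ tr u)
        ; visits≤ = visited
        }
        where
        rare′ : mult w (concat (replicate t near)) + mult w (visits v es) < t
        rare′ = subst (_< t) (mult-++ w (concat (replicate t near)) _) rare
        far : ∀ {ℓ} → ℓ < k → ¬ EdgeWalk es w v ℓ
        far ℓ<k ws with near-or-full ℓ<k (reverse ws)
        ... | inj₁ w∈   = <⇒≱ rare′ (≤-trans (∈⇒mult-replicate t w∈) (m≤m+n _ _))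
        ... | inj₂ full = <⇒≱ rare′ (≤-trans full (m≤n+m _ _))
        visited : ∀ u → mult u (w ∷ visits v es) ≤ t
        visited u with u ≟ w
        ... | yes refl = ≤-<-trans (m≤n+m _ _) rare′
        ... | no  _    = visits≤ tr u

      extend-trail : 1 ≤ t → 1 ≤ k → (2 * t) ^ k ≤ n → ∀ {m} → 2 * m ≤ t * n →
                     ∀ {v es} → Trail v es → length es < m → ∃[ w ] Trail w ((w , v) ∷ es)
      extend-trail 1≤t 1≤k D^k≤n {m} 2m≤tn {v} {es} tr es<m with t ≤? 1
      ... | yes t≤1 = extend [] tr (λ _ ws → inj₂ (≤-trans t≤1 (visited (end-of-walk ws))))
        (subst₂ _<_ (cong (_+ suc (length es)) (sym (*-zeroʳ t))) (*-comm t n)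
          (<-≤-trans (≤-<-trans es<m (m<m+n m (subst (0 <_) (sym (+-identityʳ m)) (≤-<-trans z≤n es<m)))) 2m≤tn))
        where
        visited : ∀ {u} → v ≡ u ⊎ ∃[ w ] Adj es w u → 1 ≤ mult u (visits v es)
        visited (inj₁ refl)           = ∈⇒mult≥1 {v} (here {xs = map proj₂ es} refl)
        visited {u} (inj₂ (_ , inj₁ e)) = ∈⇒mult≥1 {u} (there {x = v} (∈-map⁺ proj₂ e))
        visited {u} (inj₂ (_ , inj₂ e)) = ≤-trans (∈⇒mult≥1 (∈-map⁺ proj₁ e)) (heads≤ tr u)
      ... | no t≰1 = extend near tr (λ ℓ<k ws → inj₁ (∈-ball (pred-mono-≤ ℓ<k) ws))
        -- The ball costs `t * b < t * n / 3` and the visits at most `m ≤ t * n / 2`. Together this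
        -- is less than 5/6 of `n * t`; the factor 6 clears the denominators.
        (*-cancelˡ-< 6 _ _ (begin-strict
          6 * (t * b + suc (length es))                  <⟨ m<m+n _ (*-mono-≤ (s≤s (z≤n {1})) 1≤t) ⟩
          6 * (t * b + suc (length es)) + 2 * t          ≤⟨ +-monoˡ-≤ (2 * t) (*-monoʳ-≤ 6 (+-monoʳ-≤ (t * b) es<m)) ⟩
          6 * (t * b + m) + 2 * t                        ≡⟨ solve 3 (λ t b m →
                                                              con 6 :* (t :* b :+ m) :+ con 2 :* t :=
                                                              con 2 :* t :* (con 1 :+ con 3 :* b) :+ con 3 :* (con 2 :* m))
                                                              refl t b m ⟩
          2 * t * suc (3 * b) + 3 * (2 * m)              ≤⟨ +-mono-≤ (*-monoʳ-≤ (2 * t) 3b<n) (*-monoʳ-≤ 3 2m≤tn) ⟩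
          2 * t * n + 3 * (t * n)                        ≤⟨ m≤m+n _ (t * n) ⟩
          2 * t * n + 3 * (t * n) + t * n                ≡⟨ solve 2 (λ t n →
                                                              con 2 :* t :* n :+ con 3 :* (t :* n) :+ t :* n :=
                                                              con 6 :* (n :* t)) refl t n ⟩
          6 * (n * t)                                    ∎))
        where
        open ≤-Reasoning
        open +-*-Solver
        near = ball es (pred k) v
        b = length near
        degree : ∀ u → length (neighbours es u) ≤ 2 * t
        degree u = subst₂ _≤_ (sym (length-neighbours es u)) (cong (t +_) (sym (+-identityʳ t)))
          (+-mono-≤ (≤-trans (heads≤ tr u) (visits≤ tr u)) (tails≤ tr u))
        3b<n : 3 * b < n
        3b<n = <-≤-trans (ball-size (*-monoʳ-≤ 2 (≰⇒> t≰1)) degree (pred k) v)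
          (subst (λ j → (2 * t) ^ j ≤ n) (sym (suc-pred k {{>-nonZero 1≤k}})) D^k≤n)

      module _ {m} (grow : ∀ {v es} → Trail v es → length es < m → ∃[ w ] Trail w ((w , v) ∷ es)) where

        grow-segment : ∀ ℓ {v es} → Trail v es → length es + ℓ ≤ m →
          ∃[ w ] ∃[ fs ] Segment k w v fs × length fs ≡ ℓ × Trail w (fs ++ es)
        grow-segment zero tr le = _ , [] , [] , refl , tr
        grow-segment (suc ℓ) {v} {es} tr le
          with u , fs , seg , len , tr′ ← grow-segment ℓ tr (≤-trans (+-monoʳ-≤ (length es) (n≤1+n ℓ)) le)
          with w , tr″ ← grow tr′ (subst (_≤ m)
            (trans (+-comm (length es) (suc ℓ)) (cong suc (sym (trans (length-++ fs) (cong (_+ length es) len))))) le) =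
          w , (w , u) ∷ fs , ∷ seg , cong suc len , tr″

        grow-chopped : ∀ ℓ q {v₀} → Trail v₀ [] → q * ℓ ≤ m →
          ∃[ v ] ∃[ es ] ∃[ ps ] Chopped k ℓ v es ps × length es ≡ q * ℓ × length ps ≡ q × Trail v es
        grow-chopped ℓ zero tr le = _ , [] , [] , [] , refl , refl , tr
        grow-chopped ℓ (suc q) tr₀ le
          with v , es , ps , c , len , len′ , tr ← grow-chopped ℓ q tr₀ (≤-trans (m≤n+m _ ℓ) le)
          with w , fs , seg , len″ , tr′ ← grow-segment ℓ tr
            (subst (_≤ m) (trans (+-comm ℓ _) (cong (_+ ℓ) (sym len))) le) =
          w , fs ++ es , (w , v) ∷ ps , cons seg len″ c ,
          trans (length-++ fs) (cong₂ _+_ len″ len) , cong suc len′ , tr′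

      start : 1 ≤ t → ∀ v → Trail v []
      start 1≤t v = record { girth = [] ; heads≤ = λ _ → z≤n ; visits≤ = once }
        where
        once : ∀ u → mult u (v ∷ []) ≤ t
        once u with u ≟ v
        ... | yes _ = 1≤t
        ... | no  _ = z≤n

  -- The stretch enters only through the inequality `d + ℓ ≤ k` for detours, which keeps real
  -- numbers out of this statement. Every edge of the trail lies in some segment, so all `q * ℓ` of
  -- them are kept.
  dense-pairs : ∀ {n} k t ℓ q → Fin n → 1 ≤ t → (2 * t) ^ k ≤ n → 1 ≤ ℓ → ℓ + ℓ ≤ k → 2 * (q * ℓ) ≤ t * n →
    Σ[ G ∈ Graph n ] Σ[ P ∈ PairSet n ] ∣ P ∣ₚ ≡ q × (∀ u v → T (P (u , v)) → Walk G u v ℓ) ×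
      (∀ S → S ⊆ᴳ G → (∀ u v → T (P (u , v)) → ∃[ d ] Walk S u v d × d + ℓ ≤ k) → q * ℓ ≤ ∣E S ∣)
  dense-pairs {n} k t ℓ q v₀ 1≤t D^k≤n 1≤ℓ 2ℓ≤k 2m≤tn =
    let 1<k = ≤-trans (+-mono-≤ 1≤ℓ 1≤ℓ) 2ℓ≤k
        1≤k = <⇒≤ 1<k
        v , es , ps , c , len , len′ , tr =
          grow-chopped k t (extend-trail k t 1≤t 1≤k D^k≤n 2m≤tn) ℓ q (start k t 1≤t v₀) ≤-refl
        hg = Trail.girth tr
        in-es : ∀ {u v} → (u , v) ∈ ps → EdgeWalk es u v ℓ
        in-es p∈ = let as , bs , cs , eq , seg , len = segment-of-pair k c p∈ in
          subst₂ (λ es → EdgeWalk es _ _) (sym eq) len (segment-walk k (∈-++⁺ʳ as ∘ ∈-++⁺ˡ) seg)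
    in toGraph es (no-loop k 1≤k hg) , toPairSet ps ,
       trans (∣toPairSet∣ (endpoints-unique k 1≤ℓ 2ℓ≤k hg c)) len′ ,
       (λ u v p → toGraph-walk (in-es (toPairSet⁻ p))) ,
       λ S S⊆G short → subst (_≤ ∣E S ∣) len (length≤∣E∣ k S 1<k hg λ e∈ →
         let as , bs , cs , u , v , p∈ , eq , seg , len , e∈bs = segment-of-edge k c e∈
             d , ws , d+ℓ≤k = short u v (toPairSet⁺ p∈)
         in detour-keeps-segment k S as (subst (HighGirth k) eq hg)
              (λ {x} {y} e → subst (λ es → Adj es x y) eq (toGraph⁻ {loopfree = no-loop k 1≤k hg} (S⊆G x y e)))
              seg ws
              (subst (λ l → d + l ≤ k) (sym len) d+ℓ≤k) e∈bs)
    where open Greedy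

-- Choice of the integer parameters.

module Parameters where

  open Combinatorics using (least)
  open import Data.Nat.Base
    using (ℕ; zero; suc; NonZero; >-nonZero; >-nonZero⁻¹; _+_; _*_; _^_; _<_; _≤_; z≤n; s≤s; ⌊_/2⌋; ⌈_/2⌉)
  open import Data.Nat.DivMod using (_/_; m/n*n≤m; m≡m%n+[m/n]*n; m%n<n)
  open import Data.Nat.Logarithm using (⌊log₂_⌋; ⌊log₂⌊n/2⌋⌋≡⌊log₂n⌋∸1)
  open import Data.Nat.Properties
  open import Data.Nat.Solver using (module +-*-Solver)
  open import Relation.Nullary.Decidable using (¬?; decidable-stable)

  n<2^n : ∀ n → n < 2 ^ n
  n<2^n zero    = s≤s z≤n
  n<2^n (suc n) = ≤-<-trans (n<2^n n) (^-monoʳ-< 2 (s≤s (s≤s z≤n)) (n<1+n n))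

  -- The form in which the upper bound on `k` is used: it says that n^(1/k) is at least 2, so that
  -- half of its floor is still positive.
  ≤log₂⇒2^≤ : ∀ k n .{{_ : NonZero n}} → k ≤ ⌊log₂ n ⌋ → 2 ^ k ≤ n
  ≤log₂⇒2^≤ zero    n k≤ = >-nonZero⁻¹ n
  ≤log₂⇒2^≤ (suc k) n@(suc (suc n-2)) k≤ = begin
    2 * 2 ^ k           ≤⟨ *-monoʳ-≤ 2 (≤log₂⇒2^≤ k ⌊ n /2⌋
                             (subst (k ≤_) (sym (⌊log₂⌊n/2⌋⌋≡⌊log₂n⌋∸1 n)) (pred-mono-≤ k≤))) ⟩
    2 * ⌊ n /2⌋         ≡⟨ cong (⌊ n /2⌋ +_) (+-identityʳ ⌊ n /2⌋) ⟩
    ⌊ n /2⌋ + ⌊ n /2⌋   ≤⟨ +-monoʳ-≤ ⌊ n /2⌋ (⌊n/2⌋≤⌈n/2⌉ n) ⟩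
    ⌊ n /2⌋ + ⌈ n /2⌉   ≡⟨ ⌊n/2⌋+⌈n/2⌉≡n n ⟩
    n                   ∎
    where open ≤-Reasoning

  -- The predecessor of the least failure. It serves as a floor function, both for n^(1/k) and for
  -- the quotient of `k` by a rational close to `α + 1`.
  last-before-failure : ∀ {P : ℕ → Set} → (∀ j → Dec (P j)) → P 0 → ∀ m → ¬ P m → ∃[ d ] P d × ¬ P (suc d)
  last-before-failure P? p₀ m ¬pm with least (λ j → ¬? (P? j)) m ¬pm
  ... | zero  , _ , ¬p , _   = contradiction p₀ ¬p
  ... | suc d , _ , ¬p , min = d , decidable-stable (P? d) (λ ¬pd → <-irrefl refl (min d ¬pd)) , ¬p

  m<n+m/n*n : ∀ m n .{{_ : NonZero n}} → m < n + m / n * n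
  m<n+m/n*n m n = subst (_< n + m / n * n) (sym (m≡m%n+[m/n]*n m n)) (+-monoˡ-< (m / n * n) (m%n<n m n))

  root-floor : ∀ n k .{{_ : NonZero k}} → ∃[ d ] d ^ k ≤ n × n < suc d ^ k
  root-floor n k@(suc k-1) with last-before-failure (λ d → d ^ k ≤? n) z≤n (suc n)
    (<⇒≱ (subst (_≤ suc n ^ k) (^-identityʳ (suc n)) (^-monoʳ-≤ (suc n) {1} {k} (s≤s z≤n))))
  ... | d , d^k≤n , ≰n = d , d^k≤n , ≰⇒> ≰n

  -- With d = ⌊n^(1/k)⌋: q segments of ℓ edges have Θ(n^(1+1/k)) edges in total.
  Balanced : ℕ → ℕ → ℕ → ℕ → Set
  Balanced n d ℓ q = 1 ≤ q × n * suc d ≤ 16 * (q * ℓ) × 4 * (q * ℓ) ≤ n * d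

  -- The three floors `t`, `m` and `q` account for 16 = 4 * 2 * 2: `suc d ≤ 4 * t`,
  -- `t * n < 2 * suc m` and `suc m ≤ 2 * (q * ℓ)`. For the upper bound, `4 * (q * ℓ) ≤ 4 * m ≤ 2 *
  -- (t * n) ≤ n * d`.
  parameters : ∀ n k ℓ d → 1 ≤ ℓ → ℓ + ℓ ≤ k → 2 ^ k ≤ n → d ^ k ≤ n → n < suc d ^ k →
    ∃₂ λ t q → 1 ≤ t × (2 * t) ^ k ≤ n × 2 * (q * ℓ) ≤ t * n × Balanced n d ℓ q
  parameters n k ℓ d 1≤ℓ 2ℓ≤k 2^k≤n d^k≤n n<d⁺^k =
    t , q , 1≤t , ≤-trans (^-monoˡ-≤ k 2t≤d) d^k≤n , ≤-trans (*-monoʳ-≤ 2 qℓ≤m) 2m≤tn ,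
    1≤q , lower , upper
    where
    open ≤-Reasoning
    open +-*-Solver
    instance _ = >-nonZero 1≤ℓ
    t = d / 2
    m = (t * n) / 2
    q = m / ℓ
    2t≤d : 2 * t ≤ d
    2t≤d = subst (_≤ d) (*-comm t 2) (m/n*n≤m d 2)
    2m≤tn : 2 * m ≤ t * n
    2m≤tn = subst (_≤ t * n) (*-comm m 2) (m/n*n≤m (t * n) 2)
    qℓ≤m : q * ℓ ≤ m
    qℓ≤m = m/n*n≤m m ℓ
    2≤d : 2 ≤ d
    2≤d with 2 ≤? d
    ... | yes 2≤d = 2≤d
    ... | no  2≰d = contradiction (≤-trans (^-monoˡ-≤ k (≰⇒> 2≰d)) 2^k≤n) (<⇒≱ n<d⁺^k)
    d<2+2t : d < 2 + t * 2
    d<2+2t = m<n+m/n*n d 2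
    1≤t : 1 ≤ t
    1≤t with t | d<2+2t
    ... | zero  | d<2 = contradiction 2≤d (<⇒≱ d<2)
    ... | suc _ | _   = s≤s z≤n
    k<n : k < n
    k<n = <-≤-trans (n<2^n k) 2^k≤n
    -- This makes `q` positive, so that `P` is nonempty and its overhead is defined.
    ℓ≤m : ℓ ≤ m
    ℓ≤m = ≤-pred (*-cancelˡ-< 2 _ _ (begin-strict
      2 * ℓ      ≡⟨ cong (ℓ +_) (+-identityʳ ℓ) ⟩
      ℓ + ℓ      ≤⟨ 2ℓ≤k ⟩
      k          <⟨ k<n ⟩
      n          ≡⟨ *-identityˡ n ⟨
      1 * n      ≤⟨ *-monoˡ-≤ n 1≤t ⟩
      t * n      <⟨ m<n+m/n*n (t * n) 2 ⟩
      2 + m * 2  ≡⟨ *-comm (suc m) 2 ⟩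
      2 * suc m  ∎))
    m<ℓ+qℓ : m < ℓ + q * ℓ
    m<ℓ+qℓ = m<n+m/n*n m ℓ
    1≤q : 1 ≤ q
    1≤q with q | m<ℓ+qℓ
    ... | zero  | m<ℓ = contradiction ℓ≤m (<⇒≱ (subst (m <_) (+-identityʳ ℓ) m<ℓ))
    ... | suc _ | _   = s≤s z≤n
    lower : n * suc d ≤ 16 * (q * ℓ)
    lower = begin
      n * suc d               ≤⟨ *-monoʳ-≤ n d<2+2t ⟩
      n * (2 + t * 2)         ≤⟨ *-monoʳ-≤ n (+-monoˡ-≤ (t * 2) (*-monoˡ-≤ 2 1≤t)) ⟩
      n * (t * 2 + t * 2)     ≡⟨ solve 2 (λ n t → n :* (t :* con 2 :+ t :* con 2) := con 4 :* (t :* n)) refl n t ⟩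
      4 * (t * n)             ≤⟨ *-monoʳ-≤ 4 (<⇒≤ (m<n+m/n*n (t * n) 2)) ⟩
      4 * (suc m * 2)         ≤⟨ *-monoʳ-≤ 4 (*-monoˡ-≤ 2 (≤-trans m<ℓ+qℓ
                                    (+-monoˡ-≤ (q * ℓ) (subst (_≤ q * ℓ) (*-identityˡ ℓ) (*-monoˡ-≤ ℓ 1≤q))))) ⟩
      4 * ((q * ℓ + q * ℓ) * 2)  ≡⟨ solve 1 (λ x → con 4 :* ((x :+ x) :* con 2) := con 16 :* x) refl (q * ℓ) ⟩
      16 * (q * ℓ)            ∎
    upper : 4 * (q * ℓ) ≤ n * d
    upper = begin
      4 * (q * ℓ)   ≤⟨ *-monoʳ-≤ 4 qℓ≤m ⟩
      4 * m         ≡⟨ *-assoc 2 2 m ⟩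
      2 * (2 * m)   ≤⟨ *-monoʳ-≤ 2 2m≤tn ⟩
      2 * (t * n)   ≡⟨ solve 2 (λ t n → con 2 :* (t :* n) := n :* (con 2 :* t)) refl t n ⟩
      n * (2 * t)   ≤⟨ *-monoʳ-≤ n 2t≤d ⟩
      n * d         ∎

-- Rational estimates behind the real inequalities.

module Estimates where

  open Parameters using (last-before-failure; Balanced)
  open import Data.Integer.Base as ℤ using ()
  import Data.Integer.Properties as ℤP
  open import Data.Nat.Base as ℕ using (ℕ; zero; suc; NonZero)
  import Data.Nat.Properties as ℕP
  open import Data.Rational.Base as ℚ
    using (ℚ; 0ℚ; 1ℚ; ½; _+_; _*_; _≤_; _<_; _/_; toℚᵘ; Positive; positive; nonNegative)
  open import Data.Rational.Properties
  open import Data.Rational.Solver using (module +-*-Solver)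
  import Data.Rational.Unnormalised.Base as ℚᵘ
  import Data.Rational.Unnormalised.Properties as ℚᵘP
  open import Algebra.Definitions.RawSemiring +-*-rawSemiring using (_^_)
  open import Defs
  open ℝ≥0

  ι : ℕ → ℚ
  ι m = ℤ.+ m / 1

  0≤ι : ∀ m → 0ℚ ≤ ι m
  0≤ι m = 0≤/ m 1

  ι-+ : ∀ m n → ι (m ℕ.+ n) ≡ ι m + ι n
  ι-+ zero    n = sym (+-identityˡ (ι n))
  ι-+ (suc m) n = begin
    ι (suc (m ℕ.+ n))   ≡⟨ suc/1 (m ℕ.+ n) ⟩
    1ℚ + ι (m ℕ.+ n)    ≡⟨ cong (1ℚ +_) (ι-+ m n) ⟩
    1ℚ + (ι m + ι n)    ≡⟨ +-assoc 1ℚ (ι m) (ι n) ⟨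
    1ℚ + ι m + ι n      ≡⟨ cong (_+ ι n) (suc/1 m) ⟨
    ι (suc m) + ι n     ∎
    where open ≡-Reasoning

  ι-* : ∀ m n → ι (m ℕ.* n) ≡ ι m * ι n
  ι-* zero    n = sym (*-zeroˡ (ι n))
  ι-* (suc m) n = begin
    ι (n ℕ.+ m ℕ.* n)     ≡⟨ ι-+ n (m ℕ.* n) ⟩
    ι n + ι (m ℕ.* n)     ≡⟨ cong₂ _+_ (sym (*-identityˡ (ι n))) (ι-* m n) ⟩
    1ℚ * ι n + ι m * ι n  ≡⟨ *-distribʳ-+ (ι n) 1ℚ (ι m) ⟨
    (1ℚ + ι m) * ι n      ≡⟨ cong (_* ι n) (suc/1 m) ⟨
    ι (suc m) * ι n       ∎
    where open ≡-Reasoning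

  ι-^ : ∀ m k → ι (m ℕ.^ k) ≡ ι m ^ k
  ι-^ m zero    = refl
  ι-^ m (suc k) = trans (ι-* m (m ℕ.^ k)) (cong (ι m *_) (ι-^ m k))

  ι-mono-≤ : ∀ {m n} → m ℕ.≤ n → ι m ≤ ι n
  ι-mono-≤ {m} m≤n with j , refl ← ℕP.m≤n⇒∃[o]m+o≡n m≤n =
    subst (ι m ≤_) (sym (ι-+ m j)) (p≤p+q (0≤ι j))

  ι-cancel-< : ∀ {m n} → ι m < ι n → m ℕ.< n
  ι-cancel-< {m} {n} ιm<ιn = ℕP.≰⇒> λ n≤m → <-irrefl {ι m} refl (<-≤-trans ιm<ιn (ι-mono-≤ {n} {m} n≤m))

  0<ι : ∀ {m} → 1 ℕ.≤ m → 0ℚ < ι m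
  0<ι 1≤m = <-≤-trans (positive⁻¹ 1ℚ) (ι-mono-≤ 1≤m)

  /-*-ι : ∀ m d .{{_ : NonZero d}} → ℤ.+ m / d * ι d ≡ ι m
  /-*-ι m d@(suc d-1) = toℚᵘ-injective (begin
    toℚᵘ (ℤ.+ m / d * ι d)                        ≈⟨ toℚᵘ-homo-* (ℤ.+ m / d) (ι d) ⟩
    toℚᵘ (ℤ.+ m / d) ℚᵘ.* toℚᵘ (ι d)              ≈⟨ ℚᵘP.*-cong (toℚᵘ-fromℚᵘ (ℚᵘ.mkℚᵘ (ℤ.+ m) d-1))
                                                                   (toℚᵘ-fromℚᵘ (ℚᵘ.mkℚᵘ (ℤ.+ d) 0)) ⟩
    ℚᵘ.mkℚᵘ (ℤ.+ m) d-1 ℚᵘ.* ℚᵘ.mkℚᵘ (ℤ.+ d) 0    ≈⟨ ℚᵘ.*≡* (trans (ℤP.*-identityʳ _)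
                                                       (cong (λ j → ℤ.+ m ℤ.* ℤ.+ j) (sym (ℕP.*-identityʳ d)))) ⟩
    ℚᵘ.mkℚᵘ (ℤ.+ m) 0                             ≈⟨ toℚᵘ-fromℚᵘ (ℚᵘ.mkℚᵘ (ℤ.+ m) 0) ⟨
    toℚᵘ (ι m)                                    ∎)
    where open ℚᵘP.≃-Reasoning

  *-monoˡ : ∀ {p q r} → 0ℚ ≤ r → p ≤ q → r * p ≤ r * q
  *-monoˡ {r = r} 0≤r = *-monoˡ-≤-nonNeg r {{nonNegative 0≤r}}

  *-monoʳ : ∀ {p q r} → 0ℚ ≤ r → p ≤ q → p * r ≤ q * r
  *-monoʳ {r = r} 0≤r = *-monoʳ-≤-nonNeg r {{nonNegative 0≤r}}

  root-lower : ∀ {n k d s} .{{_ : NonZero k}} → d ℕ.^ k ℕ.≤ n → U (root k n) s → ι d ≤ s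
  root-lower {n} {k} {d} {s} d^k≤n Us = ordered (root k n)
    (0≤ι d , subst (_≤ ι n) (ι-^ d k) (ι-mono-≤ d^k≤n)) Us

  root-upper : ∀ {n k d r} .{{_ : NonZero k}} → n ℕ.< d ℕ.^ k → L (root k n) r → r ≤ ι d
  root-upper {n} {k} {d} {r} n<d^k Lr = ordered (root k n) Lr
    (0≤ι d , subst (ι n ≤_) (ι-^ d k) (ι-mono-≤ (ℕP.<⇒≤ n<d^k)))

  module _ (α : ℝ≥0) {k ℓ : ℕ} (ℓ[α+1]≤k : ∀ {a} → L α a → ι ℓ * (a + 1ℚ) ≤ ι k) where

    -- Bounds `a` and `b` of `α` with a gap `δ`, where `δ * ℓ ≤ ½`, give `d + ℓ ≤ k + ½`;
    -- integrality removes the half.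
    detour-short : ∀ {d} → (∀ {b} → U α b → ι d ≤ b * ι ℓ) → d ℕ.+ ℓ ℕ.≤ k
    detour-short {d} d≤αℓ =
      let δ , 0<δ , _ , δℓ≤½ = small {ι ℓ} {½} (0≤ι ℓ) (positive⁻¹ ½)
          a , b , La , Ub , b≤a+δ = tight α 0<δ
      in ℕP.≤-pred (ι-cancel-< (begin-strict
        ι (d ℕ.+ ℓ)                 ≡⟨ ι-+ d ℓ ⟩
        ι d + ι ℓ                   ≤⟨ +-monoˡ-≤ (ι ℓ) (≤-trans (d≤αℓ Ub) (*-monoʳ (0≤ι ℓ) b≤a+δ)) ⟩
        (a + δ) * ι ℓ + ι ℓ         ≡⟨ solve 3 (λ a δ l → (a :+ δ) :* l :+ l := l :* (a :+ con 1ℚ) :+ δ :* l)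
                                         refl a δ (ι ℓ) ⟩
        ι ℓ * (a + 1ℚ) + δ * ι ℓ    ≤⟨ +-mono-≤ (ℓ[α+1]≤k La) δℓ≤½ ⟩
        ι k + ½                     <⟨ +-monoʳ-< (ι k) {½} {1ℚ} (ℚ.*<* (ℤ.+<+ (ℕ.s≤s (ℕ.s≤s ℕ.z≤n)))) ⟩
        ι k + 1ℚ                    ≡⟨ trans (+-comm (ι k) 1ℚ) (sym (suc/1 k)) ⟩
        ι (suc k)                   ∎))
      where
      open ≤-Reasoning
      open +-*-Solver

  module _ (α : ℝ≥0) (1≤α : fromℕ 1 ≤ᴿ α) where

    1≤U : ∀ {b} → U α b → 1ℚ ≤ b
    1≤U = 1≤α refl

    -- ⌊k/(α+1)⌋ is not computable from α, so α is replaced by a rational upper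
    -- bound within 1 of it; if this makes the floor 0, then ℓ = 1 will do.
    segment-length : ∀ k → α +ᴿ fromℕ 1 ≤ᴿ fromℕ k → ∃[ ℓ ] 1 ℕ.≤ ℓ ×
      (∀ {a} → L α a → ι ℓ * (a + 1ℚ) ≤ ι k) × (∀ {b} → U α b → ι k ≤ ι 6 * b * ι ℓ)
    segment-length k α+1≤k =
      let ℓ , ℓy≤k , ¬[1+ℓ]y≤k = last-before-failure (λ ℓ → ι ℓ * y ≤? ι k) 0≤k (suc k)
                                   (λ le → <-irrefl refl (<-≤-trans k<[1+k]y le))
      in choose ℓ ℓy≤k (<⇒≤ (≰⇒> ¬[1+ℓ]y≤k))
      where
      open ≤-Reasoning
      open +-*-Solver
      approximation = tight α (positive⁻¹ 1ℚ)
      a₀ = proj₁ approximation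
      b₀ = proj₁ (proj₂ approximation)
      La₀ : L α a₀
      La₀ = proj₁ (proj₂ (proj₂ approximation))
      Ub₀ : U α b₀
      Ub₀ = proj₁ (proj₂ (proj₂ (proj₂ approximation)))
      b₀≤a₀+1 : b₀ ≤ a₀ + 1ℚ
      b₀≤a₀+1 = proj₂ (proj₂ (proj₂ (proj₂ approximation)))
      y = b₀ + 1ℚ
      0≤k : ι 0 * y ≤ ι k
      0≤k = ≤-trans (≤-reflexive (*-zeroˡ y)) (0≤ι k)
      k<[1+k]y : ι k < ι (suc k) * y
      k<[1+k]y = begin-strict
        ι k                    ≡⟨ +-identityˡ (ι k) ⟨
        0ℚ + ι k               <⟨ +-monoˡ-< (ι k) (positive⁻¹ 1ℚ) ⟩
        1ℚ + ι k               ≡⟨ suc/1 k ⟨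
        ι (suc k)              ≡⟨ *-identityʳ (ι (suc k)) ⟨
        ι (suc k) * 1ℚ         ≤⟨ *-monoˡ (0≤ι (suc k)) (≤-trans (1≤U Ub₀) (p≤p+q 0≤1)) ⟩
        ι (suc k) * y          ∎
      y≤3b : ∀ {b} → U α b → y ≤ ι 3 * b
      y≤3b {b} Ub = begin
        b₀ + 1ℚ             ≤⟨ +-monoˡ-≤ 1ℚ b₀≤a₀+1 ⟩
        a₀ + 1ℚ + 1ℚ        ≤⟨ +-mono-≤ (+-mono-≤ (ordered α La₀ Ub) (1≤U Ub)) (1≤U Ub) ⟩
        b + b + b           ≡⟨ solve 1 (λ b → b :+ b :+ b := con (ι 3) :* b) refl b ⟩
        ι 3 * b             ∎
      -- The 6 is 2 * 3: `y ≤ 3 * b` because `1 ≤ α`, and the first multiple of `y` beyond `k` has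
      -- index at most twice the chosen length.
      k≤ : ∀ {b m ℓ} → U α b → ι k ≤ ι m * y → m ℕ.≤ 2 ℕ.* ℓ → ι k ≤ ι 6 * b * ι ℓ
      k≤ {b} {m} {ℓ} Ub k≤my m≤2ℓ = begin
        ι k                     ≤⟨ k≤my ⟩
        ι m * y                 ≤⟨ *-mono-≤ (0≤ι m) (ι-mono-≤ m≤2ℓ)
                                     (≤-trans (U-nonNeg α Ub₀) (p≤p+q 0≤1)) (y≤3b Ub) ⟩
        ι (2 ℕ.* ℓ) * (ι 3 * b) ≡⟨ cong (_* (ι 3 * b)) (ι-* 2 ℓ) ⟩
        ι 2 * ι ℓ * (ι 3 * b)   ≡⟨ solve 2 (λ l b → con (ι 2) :* l :* (con (ι 3) :* b) := con (ι 6) :* b :* l)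
                                     refl (ι ℓ) b ⟩
        ι 6 * b * ι ℓ           ∎
      choose : ∀ ℓ → ι ℓ * y ≤ ι k → ι k ≤ ι (suc ℓ) * y → ∃[ ℓ ] 1 ℕ.≤ ℓ ×
        (∀ {a} → L α a → ι ℓ * (a + 1ℚ) ≤ ι k) × (∀ {b} → U α b → ι k ≤ ι 6 * b * ι ℓ)
      choose zero          _    k≤y = 1 , ℕ.s≤s ℕ.z≤n ,
        (λ {a} La → ≤-trans (≤-reflexive (*-identityˡ (a + 1ℚ))) (α+1≤k (a , 1ℚ , La , refl , refl) refl)) ,
        (λ {b} Ub → k≤ {b} {1} {1} Ub k≤y (ℕ.s≤s ℕ.z≤n))
      choose ℓ@(suc ℓ-1) ℓy≤k k≤y = ℓ , ℕ.s≤s ℕ.z≤n ,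
        (λ {a} La → ≤-trans (*-monoˡ (0≤ι ℓ) (+-monoˡ-≤ 1ℚ (ordered α La Ub₀))) ℓy≤k) ,
        (λ {b} Ub → k≤ {b} {suc ℓ} {ℓ} Ub k≤y (ℕ.s≤s
          (ℕP.≤-trans (ℕP.≤-reflexive (sym (ℕP.+-identityʳ ℓ))) (ℕP.m≤n+m (ℓ ℕ.+ 0) ℓ-1))))

  module _ (α : ℝ≥0) {n k d ℓ q : ℕ} .{{_ : NonZero k}}
           (d^k≤n : d ℕ.^ k ℕ.≤ n) (n<d⁺^k : n ℕ.< suc d ℕ.^ k) (balanced : Balanced n d ℓ q) where

    open ≤-Reasoning
    open +-*-Solver

    x = ℤ.+ 1 / k
    kx≡1 : x * ι k ≡ 1ℚ
    kx≡1 = /-*-ι 1 k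
    0≤x : 0ℚ ≤ x
    0≤x = 0≤/ 1 k
    1≤q = proj₁ balanced
    0≤qℓ : 0ℚ ≤ ι q * ι ℓ
    0≤qℓ = 0≤* (0≤ι q) (0≤ι ℓ)

    -- Together with `≤ns` this places n^(1+1/k) between `4 * (q * ℓ)` and `16 * (q * ℓ)`, by
    -- replacing the root with `suc d` or `d`.
    nr≤ : ∀ {r} → L (root k n) r → ι n * r ≤ ι 16 * (ι q * ι ℓ)
    nr≤ {r} Lr = begin
      ι n * r                ≤⟨ *-monoˡ (0≤ι n) (root-upper n<d⁺^k Lr) ⟩
      ι n * ι (suc d)        ≡⟨ ι-* n (suc d) ⟨
      ι (n ℕ.* suc d)        ≤⟨ ι-mono-≤ (proj₁ (proj₂ balanced)) ⟩
      ι (16 ℕ.* (q ℕ.* ℓ))   ≡⟨ trans (ι-* 16 (q ℕ.* ℓ)) (cong (ι 16 *_) (ι-* q ℓ)) ⟩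
      ι 16 * (ι q * ι ℓ)     ∎

    ≤ns : ∀ {s} → U (root k n) s → ι 4 * (ι q * ι ℓ) ≤ ι n * s
    ≤ns {s} Us = begin
      ι 4 * (ι q * ι ℓ)     ≡⟨ trans (ι-* 4 (q ℕ.* ℓ)) (cong (ι 4 *_) (ι-* q ℓ)) ⟨
      ι (4 ℕ.* (q ℕ.* ℓ))   ≤⟨ ι-mono-≤ (proj₂ (proj₂ balanced)) ⟩
      ι (n ℕ.* d)           ≡⟨ ι-* n d ⟩
      ι n * ι d             ≤⟨ *-monoˡ (0≤ι n) (root-lower d^k≤n Us) ⟩
      ι n * s               ∎

    -- The 1/16 cancels the 16 of `nr≤`, leaving q(ℓα/k), which is at most `q` because ℓα ≤ ℓ(α + 1)
    -- ≤ k.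
    pairs-lower : (∀ {a} → L α a → ι ℓ * (a + 1ℚ) ≤ ι k) →
                  ratio 1 16 *ᴿ (α /ᴺ k *ᴿ n ^1+1/ k) ≤ᴿ fromℕ q
    pairs-lower ℓ[α+1]≤k
      (_ , _ , refl , (_ , _ , (a , _ , La , refl , refl) , (_ , r , refl , Lr , refl) , refl) , refl) refl = begin
      ℤ.+ 1 / 16 * (a * x * (ι n * r))             ≤⟨ *-monoˡ (0≤/ 1 16) (*-monoˡ (0≤* (nonNeg α La) 0≤x) (nr≤ Lr)) ⟩
      ℤ.+ 1 / 16 * (a * x * (ι 16 * (ι q * ι ℓ)))  ≡⟨ solve 4 (λ a x q l →
                                                       con (ℤ.+ 1 / 16) :* (a :* x :* (con (ι 16) :* (q :* l))) :=
                                                       q :* (x :* (l :* a))) refl a x (ι q) (ι ℓ) ⟩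
      ι q * (x * (ι ℓ * a))                        ≤⟨ *-monoˡ (0≤ι q) (*-monoˡ 0≤x
                                                       (≤-trans (*-monoˡ (0≤ι ℓ) (p≤p+q 0≤1)) (ℓ[α+1]≤k La))) ⟩
      ι q * (x * ι k)                              ≡⟨ trans (cong (ι q *_) kx≡1) (*-identityʳ (ι q)) ⟩
      ι q                                          ∎

    -- Here q = qk/k ≤ 6qαℓ/k, and 6qℓ is 3/2 of the 4qℓ bounded by `≤ns`.
    pairs-upper : (∀ {b} → U α b → ι k ≤ ι 6 * b * ι ℓ) →
                  fromℕ q ≤ᴿ ratio 3 2 *ᴿ (α /ᴺ k *ᴿ n ^1+1/ k)
    pairs-upper k≤6αℓ refl
      (_ , _ , refl , (_ , _ , (b , _ , Ub , refl , refl) , (_ , s , refl , Us , refl) , refl) , refl) = begin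
      ι q                                          ≡⟨ trans (cong (ι q *_) kx≡1) (*-identityʳ (ι q)) ⟨
      ι q * (x * ι k)                              ≤⟨ *-monoˡ (0≤ι q) (*-monoˡ 0≤x (k≤6αℓ Ub)) ⟩
      ι q * (x * (ι 6 * b * ι ℓ))                  ≡⟨ solve 4 (λ b x q l →
                                                       q :* (x :* (con (ι 6) :* b :* l)) :=
                                                       con (ℤ.+ 3 / 2) :* (b :* x :* (con (ι 4) :* (q :* l)))) refl b x (ι q) (ι ℓ) ⟩
      ℤ.+ 3 / 2 * (b * x * (ι 4 * (ι q * ι ℓ)))    ≤⟨ *-monoˡ (0≤/ 3 2) (*-monoˡ (0≤* (U-nonNeg α Ub) 0≤x) (≤ns Us)) ⟩
      ℤ.+ 3 / 2 * (b * x * (ι n * s))              ∎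

    edges-lower : ∀ {e} → q ℕ.* ℓ ℕ.≤ e → ratio 1 16 *ᴿ (n ^1+1/ k) ≤ᴿ fromℕ e
    edges-lower {e} qℓ≤e (_ , _ , refl , (_ , r , refl , Lr , refl) , refl) refl = begin
      ℤ.+ 1 / 16 * (ι n * r)                       ≤⟨ *-monoˡ (0≤/ 1 16) (nr≤ Lr) ⟩
      ℤ.+ 1 / 16 * (ι 16 * (ι q * ι ℓ))            ≡⟨ solve 2 (λ q l →
                                                       con (ℤ.+ 1 / 16) :* (con (ι 16) :* (q :* l)) :=
                                                       q :* l) refl (ι q) (ι ℓ) ⟩
      ι q * ι ℓ                                    ≡⟨ ι-* q ℓ ⟨
      ι (q ℕ.* ℓ)                                  ≤⟨ ι-mono-≤ qℓ≤e ⟩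
      ι e                                          ∎

    -- Each pair forces `ℓ` edges and k ≤ 6αℓ, so the overhead is at least ℓ ≥ k/(6α). Dividing the
    -- bounds on edges and pairs would give only 1/24.
    overhead-lower : .{{_ : NonZero q}} (1≤α : fromℕ 1 ≤ᴿ α) →
      (∀ {b} → U α b → ι k ≤ ι 6 * b * ι ℓ) → ∀ {e} → q ℕ.* ℓ ℕ.≤ e →
      ratio 1 6 *ᴿ (fromℕ k *ᴿ inverse α (1≤⇒0< α 1≤α)) ≤ᴿ ratio e q
    overhead-lower 1≤α k≤6αℓ {e} qℓ≤e
      (_ , _ , refl , (_ , c , refl , (0≤c , b , Ub , cb≤1) , refl) , refl) refl =
      *-cancelʳ-≤-pos (ι q) (begin
      ℤ.+ 1 / 6 * (ι k * c) * ι q                  ≤⟨ *-monoʳ (0≤ι q) (*-monoˡ (0≤/ 1 6) (*-monoʳ 0≤c (k≤6αℓ Ub))) ⟩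
      ℤ.+ 1 / 6 * (ι 6 * b * ι ℓ * c) * ι q        ≡⟨ solve 4 (λ b c q l →
                                                       con (ℤ.+ 1 / 6) :* (con (ι 6) :* b :* l :* c) :* q :=
                                                       q :* l :* (c :* b)) refl b c (ι q) (ι ℓ) ⟩
      ι q * ι ℓ * (c * b)                          ≤⟨ *-monoˡ 0≤qℓ cb≤1 ⟩
      ι q * ι ℓ * 1ℚ                               ≡⟨ trans (*-identityʳ (ι q * ι ℓ)) (sym (ι-* q ℓ)) ⟩
      ι (q ℕ.* ℓ)                                  ≤⟨ ι-mono-≤ qℓ≤e ⟩
      ι e                                          ≡⟨ /-*-ι e q ⟨
      ℤ.+ e / q * ι q                              ∎)
      where instance
        posq : Positive (ι q)
        posq = positive (0<ι 1≤q)

-- Assembly of the hard instance.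

open import Data.Bool.Base using (T)
open import Data.Fin.Base using (Fin; zero)
open import Data.Integer.Base using (+_)
open import Data.Nat.Base using (ℕ; suc; NonZero; _<_; _≤_; _+_; _^_; >-nonZero)
open import Data.Nat.Logarithm using (⌊log₂_⌋)
open import Data.Nat.Properties using (n<1+n)
open import Data.Rational.Base as ℚ using (1ℚ; _/_)
import Data.Rational.Properties as ℚP
open import Function.Base using (case_of_)
open import Defs
open ℝ≥0
open Combinatorics using (dense-pairs; module Greedy)
open Parameters using (≤log₂⇒2^≤; root-floor; parameters; Balanced)
open Estimates

HardInstance : ∀ n k .{{_ : NonZero k}} (α : ℝ≥0) → fromℕ 1 ≤ᴿ α → Set
HardInstance n k α 1≤α =
  Σ[ G ∈ Graph n ] Σ[ P ∈ PairSet n ] Σ[ P≢∅ ∈ NonZero ∣ P ∣ₚ ]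
  (ratio 1 16 *ᴿ (α /ᴺ k *ᴿ n ^1+1/ k) ≤ᴿ fromℕ ∣ P ∣ₚ) ×
  (fromℕ ∣ P ∣ₚ ≤ᴿ ratio 3 2 *ᴿ (α /ᴺ k *ᴿ n ^1+1/ k)) ×
  (∀ (S : Graph n) → IsPairwiseSpanner α P G S →
  (ratio 1 16 *ᴿ (n ^1+1/ k) ≤ᴿ fromℕ ∣E S ∣) ×
  (ratio 1 6 *ᴿ (fromℕ k *ᴿ inverse α (1≤⇒0< α 1≤α)) ≤ᴿ overhead P {{P≢∅}} S))

hard-instance : ∀ n k .{{_ : NonZero k}} α (1≤α : fromℕ 1 ≤ᴿ α) → Fin n → 2 ^ k ≤ n →
  (∃[ ℓ ] 1 ≤ ℓ × (∀ {a} → L α a → ι ℓ ℚ.* (a ℚ.+ 1ℚ) ℚ.≤ ι k) ×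
    (∀ {b} → U α b → ι k ℚ.≤ ι 6 ℚ.* b ℚ.* ι ℓ)) →
  HardInstance n k α 1≤α
hard-instance n k α 1≤α v₀ 2^k≤n (ℓ , 1≤ℓ , ℓ[α+1]≤k , k≤6αℓ) =
  case root-floor n k of λ { (d , d^k≤n , n<d⁺^k) →
  case parameters n k ℓ d 1≤ℓ 2ℓ≤k 2^k≤n d^k≤n n<d⁺^k of λ { (t , q , 1≤t , D^k≤n , 2qℓ≤tn , balanced) →
  case dense-pairs k t ℓ q v₀ 1≤t D^k≤n 1≤ℓ 2ℓ≤k 2qℓ≤tn of λ { (G , P , refl , walks , dense) →
    G , P , >-nonZero (proj₁ balanced) ,
    (λ {_} {_} → pairs-lower α d^k≤n n<d⁺^k balanced ℓ[α+1]≤k) ,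
    (λ {_} {_} → pairs-upper α d^k≤n n<d⁺^k balanced k≤6αℓ) ,
    λ { S (S⊆G , stretch) →
      (λ {_} {_} → edges-lower α d^k≤n n<d⁺^k balanced (dense S S⊆G (short stretch walks))) ,
      (λ {_} {_} → overhead-lower α d^k≤n n<d⁺^k balanced {{>-nonZero (proj₁ balanced)}} 1≤α k≤6αℓ
                     (dense S S⊆G (short stretch walks))) } } } }
  where
  2ℓ≤k : ℓ + ℓ ≤ k
  -- A segment is itself a detour of length `ℓ ≤ α * ℓ`, as `1 ≤ α`.
  2ℓ≤k = detour-short α ℓ[α+1]≤k {ℓ} λ {b} Ub →
    subst (ℚ._≤ b ℚ.* ι ℓ) (ℚP.*-identityˡ (ι ℓ)) (*-monoʳ (0≤ι ℓ) (1≤α refl Ub))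
  -- The distance `e` in `G` is at most `ℓ`, so the spanner offers a walk of length at most αe ≤ αℓ,
  -- to which `detour-short` applies.
  short : ∀ {G S : Graph n} {P : PairSet n} → (∀ u v → T (P (u , v)) → StretchAtMost α G S u v) →
          (∀ u v → T (P (u , v)) → Walk G u v ℓ) → ∀ u v → T (P (u , v)) → ∃[ d ] Walk S u v d × d + ℓ ≤ k
  short stretch walks u v p = case Greedy.distance-≤ (walks u v p) of λ { (e , e≤ℓ , distance) →
    case stretch u v p e distance of λ { (d , (ws , _) , d≤αe) →
      d , ws , detour-short α ℓ[α+1]≤k {d} λ {b} Ub →
        ℚP.≤-trans (d≤αe refl (b , ι e , Ub , refl , refl)) (*-monoˡ (U-nonNeg α Ub) (ι-mono-≤ e≤ℓ)) } }

theorem9 : Σ[ c₁ ∈ ℝ≥0 ] Σ[ c₂ ∈ ℝ≥0 ] Σ[ c₃ ∈ ℝ≥0 ] Σ[ c₄ ∈ ℝ≥0 ]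
    (0< c₁) × (0< c₂) × (0< c₃) × (0< c₄) ×
    (∀ (N : ℕ) → Σ[ n ∈ ℕ ] N < n ×
    (∀ (α : ℝ≥0) (1≤α : fromℕ 1 ≤ᴿ α) (k : ℕ) .{{_ : NonZero k}} →
    α +ᴿ fromℕ 1 ≤ᴿ fromℕ k → k ≤ ⌊log₂ n ⌋ →
    Σ[ G ∈ Graph n ] Σ[ P ∈ PairSet n ] Σ[ P≢∅ ∈ NonZero ∣ P ∣ₚ ]
    (c₁ *ᴿ (α /ᴺ k *ᴿ n ^1+1/ k) ≤ᴿ fromℕ ∣ P ∣ₚ) ×
    (fromℕ ∣ P ∣ₚ ≤ᴿ c₂ *ᴿ (α /ᴺ k *ᴿ n ^1+1/ k)) ×
    (∀ (S : Graph n) → IsPairwiseSpanner α P G S →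
    (c₃ *ᴿ (n ^1+1/ k) ≤ᴿ fromℕ ∣E S ∣) ×
    (c₄ *ᴿ (fromℕ k *ᴿ inverse α (1≤⇒0< α 1≤α)) ≤ᴿ overhead P {{P≢∅}} S))))
theorem9 =
  ratio 1 16 , ratio 3 2 , ratio 1 16 , ratio 1 6 ,
  (+ 1 / 16 , refl , ℚP.positive⁻¹ (+ 1 / 16)) , (+ 3 / 2 , refl , ℚP.positive⁻¹ (+ 3 / 2)) ,
  (+ 1 / 16 , refl , ℚP.positive⁻¹ (+ 1 / 16)) , (+ 1 / 6 , refl , ℚP.positive⁻¹ (+ 1 / 6)) ,
  -- Every positive `n` qualifies, so `suc N` serves as an `n` beyond `N`; the trail starts at the
  -- vertex `zero`.
  λ N → suc N , n<1+n N , λ α 1≤α k α+1≤k k≤log₂n →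
    hard-instance (suc N) k α 1≤α zero (≤log₂⇒2^≤ k (suc N) k≤log₂n) (segment-length α 1≤α k α+1≤k)
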